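{- There is a function $\varepsilon(n)$ with $\varepsilon(n)\to 0$ as $n\to\infty$ such that for every positive integer $n$, \[T(n)\le \left((1+\varepsilon(n))\frac{n}{e^3}\right)^{n}.\]
   Context: Index the rows and columns of an $n\times n$ board by $\mathbb{Z}_n$. A toroidal $n$-queens configuration is a set $\{(x_i,y_i)\}_{i=1}^n\subseteq \mathbb{Z}_n^2$ such that each of $\{x_i\}_i$, $\{y_i\}_i$, $\{x_i+y_i\}_i$, $\{x_i-y_i\}_i$ equals all of $\mathbb{Z}_n$. $T(n)$ denotes the number of toroidal $n$-queens configurations. -}

module Defs where

open import Data.Nat as ℕ using (ℕ; zero; suc; _∸_; _!; NonZero)
open import Data.Nat.Properties using (_!≢0)
open import Data.Nat.DivMod using (_%_)
open import Data.Fin using (Fin; toℕ)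
open import Data.Fin.Properties using (any?; all?)
open import Data.Vec using (Vec; []; _∷_; lookup)
open import Data.List using (List; [_]; concatMap; map; length; filter)
open import Data.List using () renaming (allFin to allFinL)
open import Data.Product using (∃; _×_)
open import Relation.Binary.PropositionalEquality using (_≡_)
open import Relation.Nullary using (Dec; _×-dec_)
open import Relation.Unary using (Decidable)
open import Data.Integer using (+_)
open import Data.Rational as ℚ using (ℚ; _/_)

-- Toroidal n-queens configurations.
-- A configuration is a set of n cells of Z_n × Z_n whose rows are all of
-- Z_n; hence it has exactly one queen per row and is the graph of a map
-- f : Z_n → Z_n (row x ↦ column y), stored as a vector v with v[x] = f x.
-- The remaining conditions say that {f x}, {x + f x}, {x - f x} each equal
-- all of Z_n (arithmetic mod n, Z_n represented by Fin n / {0..n-1}).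

module _ {n : ℕ} .{{_ : NonZero n}} where

  ColsFull : Vec (Fin n) n → Set
  ColsFull v = ∀ (j : Fin n) → ∃ λ (i : Fin n) → lookup v i ≡ j

  SumsFull : Vec (Fin n) n → Set
  SumsFull v = ∀ (j : Fin n) → ∃ λ (i : Fin n) →
    (toℕ i ℕ.+ toℕ (lookup v i)) % n ≡ toℕ j

  DiffsFull : Vec (Fin n) n → Set
  DiffsFull v = ∀ (j : Fin n) → ∃ λ (i : Fin n) →
    (toℕ i ℕ.+ (n ∸ toℕ (lookup v i))) % n ≡ toℕ j

  IsToroidal : Vec (Fin n) n → Set
  IsToroidal v = ColsFull v × SumsFull v × DiffsFull v

  isToroidal? : Decidable IsToroidal
  isToroidal? v =
    all? (λ j → any? (λ i → lookup v i Data.Fin.≟ j))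
    ×-dec all? (λ j → any? (λ i → (toℕ i ℕ.+ toℕ (lookup v i)) % n ℕ.≟ toℕ j))
    ×-dec all? (λ j → any? (λ i → (toℕ i ℕ.+ (n ∸ toℕ (lookup v i))) % n ℕ.≟ toℕ j))

allVecs : (m k : ℕ) → List (Vec (Fin k) m)
allVecs zero    k = [ [] ]
allVecs (suc m) k = concatMap (λ v → map (_∷ v) (allFinL k)) (allVecs m k)

-- T(n): the number of toroidal n-queens configurations
-- (T 0 = 1, the empty configuration; irrelevant for the theorem, n ≥ 1).
T : ℕ → ℕ
T zero    = 1
T (suc m) = length (filter isToroidal? (allVecs (suc m) (suc m)))

_^ℚ_ : ℚ → ℕ → ℚ
q ^ℚ zero  = ℚ.1ℚ
q ^ℚ suc k = q ℚ.* (q ^ℚ k)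

ℕ→ℚ : ℕ → ℚ
ℕ→ℚ m = + m / 1

-- K-th partial sum of the exponential series at x = m:  Σ_{k=0}^{K} m^k / k!
-- These increase to e^m, so for a real R:  c · e^m ≤ R  ⇔  ∀ K, c · expPartial m K ≤ R  (c ≥ 0).
expPartial : ℕ → ℕ → ℚ
expPartial m zero    = ℚ.1ℚ
expPartial m (suc K) =
  expPartial m K ℚ.+ (+ (m ℕ.^ suc K) / (suc K !)) {{suc K !≢0}}

TendsToZero : (ℕ → ℚ) → Set
TendsToZero ε = ∀ (δ : ℚ) → ℚ.0ℚ ℚ.< δ →
  ∃ λ (N : ℕ) → ∀ (n : ℕ) → N ℕ.≤ n → ℚ.∣ ε n ∣ ℚ.< δ

{-# OPTIONS --safe #-}

-- Reveal the rows of a configuration x in a random order, and let Nᵢ be the number of columns that are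
-- free for row i when it is revealed. For a fixed order, the greedy random choice produces x with
-- probability ∏ 1/Nᵢ, so the sum of ∏ 1/Nᵢ over all x is at most 1. A column other than x's own
-- is free for i as long as the three queens of x on its lines through row i are unrevealed; n being odd,
-- these lie in three distinct rows other than i. So with j other rows unrevealed, Nᵢ has mean
-- aⱼ₊₁ = 1 + (n − 1) C(j, 3) / C(n − 1, 3). AM–GM in the form ∏ 1/uᵢ ≥ 1 + ∑ (1 − uᵢ), with u = N/a, shows
-- that the mean of ∏ aⱼ/Nⱼ over all orders is at least 1; hence T(n) ≤ ∏ aⱼ, with no entropy or logarithm.
--
-- With D = (n − 2)(n − 3) this reads T(n) Dⁿ ≤ ∏_{j<n} (D + j (j − 1) (j − 2)). For t³ ≥ D each factor is at
-- most (j + t)³, and ∏ (j + t) is n! up to a factor C(n + t, n), which is subexponential for t = n / d².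
-- Finally e³ⁿ (n!)³ exceeds n³ⁿ by at most a polynomial factor. This gives 1 + ε = (1 + 1/d)⁸, and d may
-- tend to infinity with n.

module Submission where

open import Defs
open import Data.Bool as Bool using (Bool; true; false; not; _∧_)
open import Data.Bool.Properties using (∧-identityʳ; ∧-zeroʳ)
open import Data.Fin as Fin using (Fin; zero; suc; toℕ; punchOut)
open import Data.Fin.Patterns using (0F; 1F; 2F)
open import Data.Fin.Permutation using (permutation)
open import Data.Fin.Properties as Finₚ using (all?; toℕ-injective; toℕ<n; toℕ-fromℕ<; injective⇒≤; punchOut-injective)
import Data.Integer as ℤ
import Data.Integer.Properties as ℤₚ
open import Data.List as List using (List; []; _∷_; length; filter; foldr; concatMap; map; cartesianProductWith)
open import Data.List.Membership.Propositional using (_∈_)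
open import Data.List.Membership.Propositional.Properties using (∈-filter⁻)
open import Data.List.Relation.Unary.All using (All; []; _∷_)
open import Data.List.Relation.Unary.AllPairs using ([]; _∷_)
open import Data.List.Relation.Unary.Any using (here; there)
open import Data.List.Relation.Unary.Unique.Propositional using (Unique)
import Data.List.Relation.Unary.Unique.Propositional.Properties as Uniqueₚ
open import Data.Nat as ℕ using (ℕ; zero; suc; _∸_; _!)
import Data.Nat.DivMod as DivMod
import Data.Nat.Properties as ℕₚ
import Data.Nat.Solver as ℕSolver
open import Data.Product using (∃; Σ-syntax; _×_; _,_; proj₁; proj₂)
import Data.Rational.Unnormalised as ℚᵘ
import Data.Rational.Unnormalised.Properties as ℚᵘₚ
open import Data.Sum using (_⊎_; inj₁; inj₂)
open import Data.Vec as Vec using (Vec; lookup)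
open import Data.Vec.Properties using (∷-injective; tabulate∘lookup; tabulate-cong)
open import Function using (_∘_)
open import Function.Bundles using (mk⇔)
open import Relation.Binary.PropositionalEquality hiding ([_])
open import Relation.Nullary using (Dec; does; yes; no; contradiction; ¬?; _→-dec_; _×-dec_)
open import Relation.Nullary.Decidable using (dec-true; dec-false; does-⇔)

-- An average over random orders is a recursion on the set `R` of unrevealed rows: average over the
-- next row, then over the rest. Two features of this recursion shape the proof. The tangent
-- inequality concerns the ratios of a whole order at once. The induction for the lower bound
-- therefore carries the ratios met so far and applies AM-GM only when no row is left. The mean of
-- the free counts depends on `R` through one number: how many cells off the configuration have
-- their own row and their three attacking rows all unrevealed. On average this number shrinks at
-- each step by a factor that depends only on how many rows are left, so the recursion is solved by
-- falling factorials. Oddness of n is derived from the existence of one configuration; for even n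
-- the list of configurations is empty and no separate case arises. The number e occurs only through
-- partial sums of its series, which are bounded uniformly by (2N + 2) N^N / N! with N = 3n;
-- everything else is an inequality between naturals or rationals.

module NaturalBounds where

  open import Data.Nat
  open import Data.Nat.Properties
  open import Data.Nat.Solver using (module +-*-Solver)
  open +-*-Solver

  -- Integer estimates: rising factorials, factorials and Bernoulli's inequality.

  falling₃ : ℕ → ℕ
  falling₃ m = m * (m ∸ 1) * (m ∸ 2)

  cubicProduct : ℕ → ℕ → ℕ
  cubicProduct D zero    = 1
  cubicProduct D (suc m) = (D + falling₃ m) * cubicProduct D m

  rising : ℕ → ℕ → ℕ
  rising t zero    = 1
  rising t (suc m) = t * rising (suc t) m

  rising-suc : ∀ t m → rising t (suc m) ≡ rising t m * (t + m)
  rising-suc t zero    = trans (*-identityʳ t) (sym (trans (*-identityˡ (t + 0)) (+-identityʳ t)))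
  rising-suc t (suc m) = begin
    t * rising (suc t) (suc m)             ≡⟨ cong (t *_) (rising-suc (suc t) m) ⟩
    t * (rising (suc t) m * (suc t + m))   ≡⟨ *-assoc t _ _ ⟨
    t * rising (suc t) m * (suc t + m)     ≡⟨ cong (rising t (suc m) *_) (+-suc t m) ⟨
    rising t (suc m) * (t + suc m)         ∎
    where open ≡-Reasoning

  falling₃≤ : ∀ m → falling₃ m ≤ m * m * m
  falling₃≤ m = *-mono-≤ (*-mono-≤ (≤-refl {m}) (m∸n≤m m 1)) (m∸n≤m m 2)

  cubicProduct-≤ : ∀ {D t} → D ≤ t * t * t → ∀ m → cubicProduct D m ≤ rising t m * rising t m * rising t m
  cubicProduct-≤ {D} {t} D≤t³ zero    = ≤-refl
  cubicProduct-≤ {D} {t} D≤t³ (suc m) = begin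
    (D + falling₃ m) * cubicProduct D m              ≤⟨ *-mono-≤ (+-mono-≤ D≤t³ (falling₃≤ m)) (cubicProduct-≤ D≤t³ m) ⟩
    (t * t * t + m * m * m) * (r * r * r)            ≤⟨ *-monoˡ-≤ (r * r * r) (m≤m+n (t * t * t + m * m * m) (3 * (t * t * m) + 3 * (t * m * m))) ⟩
    (t * t * t + m * m * m + (3 * (t * t * m) + 3 * (t * m * m))) * (r * r * r)
      ≡⟨ solve 3 (λ t m r → (t :* t :* t :+ m :* m :* m :+ (con 3 :* (t :* t :* m) :+ con 3 :* (t :* m :* m))) :* (r :* r :* r)
                            := (r :* (t :+ m)) :* (r :* (t :+ m)) :* (r :* (t :+ m))) refl t m r ⟩
    (r * (t + m)) * (r * (t + m)) * (r * (t + m))    ≡⟨ cong (λ z → z * z * z) (rising-suc t m) ⟨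
    rising t (suc m) * rising t (suc m) * rising t (suc m) ∎
    where
    open ≤-Reasoning
    r : ℕ
    r = rising t m

  -- rising t m = m! C(t + m − 1, m), and Pascal's rule bounds the binomial coefficient.
  rising-≤ : ∀ d t m → rising t m * d ^ m ≤ m ! * suc d ^ (m + t)
  rising-≤ d t zero = begin
    1                  ≤⟨ m^n>0 (suc d) t ⟩
    suc d ^ t          ≡⟨ +-identityʳ _ ⟨
    1 * suc d ^ t      ∎
    where open ≤-Reasoning
  rising-≤ d zero    (suc m) = z≤n
  rising-≤ d (suc t) (suc m) = begin
    rising (suc t) (suc m) * (d * d ^ m)                    ≡⟨ cong (_* (d * d ^ m)) (rising-suc (suc t) m) ⟩
    r * (suc t + m) * (d * d ^ m)                           ≡⟨ solve 5 (λ r t m d e → r :* (con 1 :+ t :+ m) :* (d :* e) := t :* r :* (d :* e) :+ (con 1 :+ m) :* d :* (r :* e)) refl r t m d (d ^ m) ⟩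
    t * r * (d * d ^ m) + suc m * d * (r * d ^ m)           ≤⟨ +-mono-≤ (rising-≤ d t (suc m)) (*-monoʳ-≤ (suc m * d) (rising-≤ d (suc t) m)) ⟩
    suc m ! * suc d ^ (suc m + t) + suc m * d * (m ! * suc d ^ (m + suc t))
      ≡⟨ cong (λ z → suc m ! * suc d ^ suc (m + t) + suc m * d * (m ! * suc d ^ z)) (+-suc m t) ⟩
    suc m ! * p + suc m * d * (m ! * p)                     ≡⟨ solve 4 (λ m d f p → (con 1 :+ m) :* f :* p :+ (con 1 :+ m) :* d :* (f :* p) := (con 1 :+ m) :* f :* ((con 1 :+ d) :* p)) refl m d (m !) p ⟩
    suc m ! * (suc d * p)                                   ≡⟨ cong (λ z → suc m ! * suc d ^ suc z) (+-suc m t) ⟨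
    suc m ! * suc d ^ (suc m + suc t)                       ∎
    where
    open ≤-Reasoning
    r p : ℕ
    r = rising (suc t) m
    p = suc d ^ suc (m + t)

  -- (3m)!/(m!)³ has order 27^m/m, so a linear factor is lost. In the step, with s = m + 2, the
  -- product 5s · 3s(3s - 1)(3s - 2) exceeds 27s³ · 5(s - 1) by exactly 30s². The constant 5 is the
  -- least integer c with 27 ≤ 6c, the base case.
  !-cubed-≤ : ∀ m → 27 ^ suc m * (suc m ! * suc m ! * suc m !) ≤ 5 * suc m * (3 * suc m) !
  !-cubed-≤ zero    = m≤m+n 27 3
  !-cubed-≤ (suc m) = begin
    27 * A * (2+m * f * (2+m * f) * (2+m * f))
      ≡⟨ solve 3 (λ s A f → con 27 :* A :* (s :* f :* (s :* f) :* (s :* f)) := con 27 :* (s :* s :* s) :* (A :* (f :* f :* f))) refl 2+m A f ⟩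
    27 * (2+m * 2+m * 2+m) * (A * (f * f * f))
      ≤⟨ *-monoʳ-≤ (27 * (2+m * 2+m * 2+m)) (!-cubed-≤ m) ⟩
    27 * (2+m * 2+m * 2+m) * (5 * suc m * F)
      ≤⟨ m≤m+n _ (30 * 2+m * 2+m * F) ⟩
    27 * (2+m * 2+m * 2+m) * (5 * suc m * F) + 30 * 2+m * 2+m * F
      ≡⟨ solve 2 (λ m F → let s = con 2 :+ m ; N = con 3 :+ con 3 :* m in
           con 27 :* (s :* s :* s) :* (con 5 :* (con 1 :+ m) :* F) :+ con 30 :* s :* s :* F
           := con 5 :* s :* ((con 3 :+ N) :* ((con 2 :+ N) :* ((con 1 :+ N) :* F)))) refl m F ⟩
    5 * 2+m * ((3 + N) * ((2 + N) * ((1 + N) * F)))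
      ≡⟨ cong (λ y → 5 * 2+m * ((3 + y) * ((2 + y) * ((1 + y) * F)))) (*-suc 3 m) ⟨
    5 * 2+m * ((3 + 3 * suc m) * ((2 + 3 * suc m) * ((1 + 3 * suc m) * F)))
      ≡⟨ cong (5 * 2+m *_) (3+-! (3 * suc m)) ⟨
    5 * 2+m * ((3 + 3 * suc m) !)
      ≡⟨ cong (λ z → 5 * 2+m * z !) (*-suc 3 (suc m)) ⟨
    5 * 2+m * (3 * 2+m) ! ∎
    where
    open ≤-Reasoning
    2+m A f F N : ℕ
    2+m = suc (suc m)
    A = 27 ^ suc m
    f = suc m !
    F = (3 * suc m) !
    N = 3 + 3 * m
    3+-! : ∀ k → (3 + k) ! ≡ (3 + k) * ((2 + k) * ((1 + k) * k !))
    3+-! k = refl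

  bernoulli : ∀ d k → d ^ k * (d + k) ≤ d * suc d ^ k
  bernoulli d zero    = ≤-reflexive (trans (*-identityˡ (d + 0)) (trans (+-identityʳ d) (sym (*-identityʳ d))))
  bernoulli d (suc k) = begin
    d * d ^ k * (d + suc k)           ≡⟨ solve 3 (λ d e k → d :* e :* (d :+ (con 1 :+ k)) := e :* (d :* (d :+ k) :+ d)) refl d (d ^ k) k ⟩
    d ^ k * (d * (d + k) + d)         ≤⟨ *-monoʳ-≤ (d ^ k) (+-monoʳ-≤ (d * (d + k)) (m≤m+n d k)) ⟩
    d ^ k * (d * (d + k) + (d + k))   ≡⟨ solve 3 (λ d e k → e :* (d :* (d :+ k) :+ (d :+ k)) := (con 1 :+ d) :* (e :* (d :+ k))) refl d (d ^ k) k ⟩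
    suc d * (d ^ k * (d + k))         ≤⟨ *-monoʳ-≤ (suc d) (bernoulli d k) ⟩
    suc d * (d * suc d ^ k)           ≡⟨ solve 3 (λ s d e → s :* (d :* e) := d :* (s :* e)) refl (suc d) d (suc d ^ k) ⟩
    d * (suc d * suc d ^ k)           ∎
    where open ≤-Reasoning

  -- This is (1 + 1/d)^(kd) ≥ 1 + k without denominators. With k = 1, a block of d factors gains 2;
  -- with k = d, a block of d² factors gains d + 1. Both gains feed `blocks`.
  bernoulli-* : ∀ d .{{_ : NonZero d}} k → suc k * d ^ (k * d) ≤ suc d ^ (k * d)
  bernoulli-* d k = *-cancelˡ-≤ d (begin
    d * (suc k * d ^ (k * d))       ≡⟨ solve 3 (λ d k e → d :* ((con 1 :+ k) :* e) := e :* (d :+ k :* d)) refl d k (d ^ (k * d)) ⟩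
    d ^ (k * d) * (d + k * d)       ≤⟨ bernoulli d (k * d) ⟩
    d * suc d ^ (k * d)             ∎)
    where open ≤-Reasoning

  ^-distribʳ-* : ∀ a b k → (a * b) ^ k ≡ a ^ k * b ^ k
  ^-distribʳ-* a b zero    = refl
  ^-distribʳ-* a b (suc k) = trans (cong (a * b *_) (^-distribʳ-* a b k))
    (solve 4 (λ a b x y → a :* b :* (x :* y) := a :* x :* (b :* y)) refl a b (a ^ k) (b ^ k))

  -- The gain c d^k ≤ (d+1)^k in a block of k factors, repeated t times within n factors.
  blocks : ∀ {c d k} t {n} → c * d ^ k ≤ suc d ^ k → k * t ≤ n → c ^ t * d ^ n ≤ suc d ^ n
  blocks {c} {d} {k} t {n} gain kt≤n = begin
    c ^ t * d ^ n                        ≡⟨ cong (λ z → c ^ t * d ^ z) (m+[n∸m]≡n kt≤n) ⟨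
    c ^ t * d ^ (k * t + r)              ≡⟨ cong (c ^ t *_) (^-distribˡ-+-* d (k * t) r) ⟩
    c ^ t * (d ^ (k * t) * d ^ r)        ≡⟨ *-assoc (c ^ t) _ _ ⟨
    c ^ t * d ^ (k * t) * d ^ r          ≡⟨ cong (λ z → c ^ t * z * d ^ r) (^-*-assoc d k t) ⟨
    c ^ t * (d ^ k) ^ t * d ^ r          ≡⟨ cong (_* d ^ r) (^-distribʳ-* c (d ^ k) t) ⟨
    (c * d ^ k) ^ t * d ^ r              ≤⟨ *-mono-≤ (^-monoˡ-≤ t gain) (^-monoˡ-≤ r (n≤1+n d)) ⟩
    (suc d ^ k) ^ t * suc d ^ r          ≡⟨ cong (_* suc d ^ r) (^-*-assoc (suc d) k t) ⟩
    suc d ^ (k * t) * suc d ^ r          ≡⟨ ^-distribˡ-+-* (suc d) (k * t) r ⟨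
    suc d ^ (k * t + r)                  ≡⟨ cong (suc d ^_) (m+[n∸m]≡n kt≤n) ⟩
    suc d ^ n                            ∎
    where
    open ≤-Reasoning
    r : ℕ
    r = n ∸ k * t

  n<2^n : ∀ n → n < 2 ^ n
  n<2^n zero    = s≤s z≤n
  n<2^n (suc n) = begin
    2 + n                ≡⟨⟩
    1 + suc n            ≤⟨ +-mono-≤ (m^n>0 2 n) (n<2^n n) ⟩
    2 ^ n + 2 ^ n        ≡⟨ cong (2 ^ n +_) (+-identityʳ (2 ^ n)) ⟨
    2 ^ suc n            ∎
    where open ≤-Reasoning

  ^-exponent-comm : ∀ a j k → (a ^ j) ^ k ≡ (a ^ k) ^ j
  ^-exponent-comm a j k = trans (^-*-assoc a j k) (trans (cong (a ^_) (*-comm j k)) (sym (^-*-assoc a k j)))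

  -- Asymptotic form of the product bound, for parameters d and t.

  module Asymptotics {d t n} (3≤d : 3 ≤ d) (d²t≤n : d * d * t ≤ n) (40n²≤t³ : 40 * (n * n) ≤ t * t * t)
                     (5d+5≤n : 5 * suc d ≤ n) where

    private instance
      d≢0 : NonZero d
      d≢0 = >-nonZero (≤-trans (s≤s z≤n) 3≤d)

    D p q f : ℕ
    D = (n ∸ 2) * (n ∸ 3)
    p = d ^ n
    q = suc d ^ n
    f = n !

    20≤n : 20 ≤ n
    20≤n = ≤-trans (*-monoʳ-≤ 5 (s≤s 3≤d)) 5d+5≤n

    rising*p²≤ : rising t n * (p * p) ≤ f * (q * q)
    rising*p²≤ = begin
      rising t n * (p * p)               ≡⟨ *-assoc (rising t n) p p ⟨
      rising t n * p * p                 ≤⟨ *-monoˡ-≤ p (rising-≤ d t n) ⟩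
      f * suc d ^ (n + t) * p            ≡⟨ cong (λ z → f * z * p) (^-distribˡ-+-* (suc d) n t) ⟩
      f * (q * suc d ^ t) * p            ≡⟨ solve 4 (λ f q s p → f :* (q :* s) :* p := f :* (q :* (s :* p))) refl f q (suc d ^ t) p ⟩
      -- The excess exponent t from `rising-≤` is paid by t blocks of d² factors, each gaining d +
      -- 1.
      f * (q * (suc d ^ t * p))          ≤⟨ *-monoʳ-≤ f (*-monoʳ-≤ q (blocks {suc d} {d} {d * d} t (bernoulli-* d d) d²t≤n)) ⟩
      f * (q * q)                        ∎
      where open ≤-Reasoning

    D≤t³ : D ≤ t * t * t
    D≤t³ = ≤-trans (*-mono-≤ (m∸n≤m n 2) (m∸n≤m n 3)) (≤-trans (m≤n*m (n * n) 40) 40n²≤t³)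

    cubicProduct*p⁶≤ : cubicProduct D n * (p * p * (p * p) * (p * p)) ≤ f * f * f * (q * q * (q * q) * (q * q))
    cubicProduct*p⁶≤ = begin
      cubicProduct D n * (p * p * (p * p) * (p * p))   ≤⟨ *-monoˡ-≤ _ (cubicProduct-≤ D≤t³ n) ⟩
      r * r * r * (p * p * (p * p) * (p * p))          ≡⟨ cube r (p * p) ⟩
      (r * (p * p)) * (r * (p * p)) * (r * (p * p))    ≤⟨ *-mono-≤ (*-mono-≤ rising*p²≤ rising*p²≤) rising*p²≤ ⟩
      (f * (q * q)) * (f * (q * q)) * (f * (q * q))    ≡⟨ cube f (q * q) ⟨
      f * f * f * (q * q * (q * q) * (q * q))          ∎
      where
      open ≤-Reasoning
      r : ℕ
      r = rising t n
      cube : ∀ a b → a * a * a * (b * b * b) ≡ (a * b) * (a * b) * (a * b)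
      cube = solve 2 (λ a b → a :* a :* a :* (b :* b :* b) := (a :* b) :* (a :* b) :* (a :* b)) refl

    -- D = n² - 5n + 6, so the loss against n² is at most 5n, and n ≥ 5(d + 1) makes it a fraction
    -- 1/(d + 1) of n². Adding 5(d + 1)n to both sides avoids subtraction.
    n²d≤ : n * n * d ≤ suc d * D
    n²d≤ = +-cancelʳ-≤ (5 * suc d * n) _ _ (begin
      n * n * d + 5 * suc d * n               ≤⟨ +-monoʳ-≤ (n * n * d) (*-monoˡ-≤ n 5d+5≤n) ⟩
      n * n * d + n * n                       ≤⟨ m≤m+n _ (6 * suc d) ⟩
      n * n * d + n * n + 6 * suc d           ≡⟨ identity n (n ∸ 3) (sym (m+[n∸m]≡n 3≤n)) ⟩
      suc d * (suc (n ∸ 3) * (n ∸ 3)) + 5 * suc d * n  ≡⟨ cong (λ z → suc d * (z * (n ∸ 3)) + 5 * suc d * n) (+-∸-assoc 1 3≤n) ⟨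
      suc d * D + 5 * suc d * n               ∎)
      where
      open ≤-Reasoning
      3≤n : 3 ≤ n
      3≤n = ≤-trans (m≤m+n 3 17) 20≤n
      identity : ∀ n k → n ≡ 3 + k → n * n * d + n * n + 6 * suc d ≡ suc d * (suc k * k) + 5 * suc d * n
      identity n k refl = solve 2 (λ d k → let n = con 3 :+ k ; s = con 1 :+ d in
        n :* n :* d :+ n :* n :+ con 6 :* s := s :* ((con 1 :+ k) :* k) :+ con 5 :* s :* n) refl d k

    n²ⁿ*p≤ : n ^ n * n ^ n * p ≤ q * D ^ n
    n²ⁿ*p≤ = begin
      n ^ n * n ^ n * p          ≡⟨ cong (_* p) (^-distribʳ-* n n n) ⟨
      (n * n) ^ n * p            ≡⟨ ^-distribʳ-* (n * n) d n ⟨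
      (n * n * d) ^ n            ≤⟨ ^-monoˡ-≤ n n²d≤ ⟩
      (suc d * D) ^ n            ≡⟨ ^-distribʳ-* (suc d) D n ⟩
      q * D ^ n                  ∎
      where open ≤-Reasoning

    -- The factor 6n + 2 comes from the partial sums of e^(3n), and 5n from `!-cubed-≤`. Their
    -- product is at most 40n² ≤ t³ ≤ 2^(3t) ≤ 2^(dt), and dt blocks of d factors, each gaining 2,
    -- fit into n.
    polynomial≤ : (6 * n + 2) * (5 * n) * p ≤ q
    polynomial≤ = begin
      (6 * n + 2) * (5 * n) * p        ≤⟨ *-monoˡ-≤ p (*-monoˡ-≤ (5 * n) (+-monoʳ-≤ (6 * n) (*-monoʳ-≤ 2 (≤-trans (s≤s z≤n) 20≤n)))) ⟩
      (6 * n + 2 * n) * (5 * n) * p    ≡⟨ cong (_* p) (solve 1 (λ n → (con 6 :* n :+ con 2 :* n) :* (con 5 :* n) := con 40 :* (n :* n)) refl n) ⟩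
      40 * (n * n) * p                 ≤⟨ *-monoˡ-≤ p 40n²≤t³ ⟩
      t * t * t * p                    ≤⟨ *-monoˡ-≤ p (*-mono-≤ (*-mono-≤ t≤2^t t≤2^t) t≤2^t) ⟩
      2 ^ t * 2 ^ t * 2 ^ t * p        ≡⟨ cong (_* p) (trans (cong (_* 2 ^ t) (sym (^-distribˡ-+-* 2 t t))) (sym (^-distribˡ-+-* 2 (t + t) t))) ⟩
      2 ^ (t + t + t) * p              ≤⟨ *-monoˡ-≤ p (^-monoʳ-≤ 2 (begin
        t + t + t                        ≡⟨ solve 1 (λ t → t :+ t :+ t := con 3 :* t) refl t ⟩
        3 * t                            ≤⟨ *-monoˡ-≤ t 3≤d ⟩
        d * t                            ∎)) ⟩
      2 ^ (d * t) * p                  ≤⟨ blocks {2} {d} {d} (d * t) gain (≤-trans (≤-reflexive (sym (*-assoc d d t))) d²t≤n) ⟩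
      q                                ∎
      where
      open ≤-Reasoning
      t≤2^t : t ≤ 2 ^ t
      t≤2^t = <⇒≤ (n<2^n t)
      gain : 2 * d ^ d ≤ suc d ^ d
      gain = subst (λ z → 2 * d ^ z ≤ suc d ^ z) (*-identityˡ d) (bernoulli-* d 1)

    27ⁿ*f³≤ : 27 ^ n * (f * f * f) ≤ 5 * n * (3 * n) !
    27ⁿ*f³≤ = positive n 20≤n
      where
      positive : ∀ n → 20 ≤ n → 27 ^ n * (n ! * n ! * n !) ≤ 5 * n * (3 * n) !
      positive (suc n) _ = !-cubed-≤ n

    -- Here (6n + 2)(3n)^(3n) / (3n)! stands for e^(3n). Eight losses of (1 + 1/d)^n add up: two for
    -- each of the three rising factorials in `cubicProduct*p⁶≤`, one for passing from n² to `D`,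
    -- and one for the polynomial factors.
    count-≤ : ∀ {T} → T * D ^ n ≤ cubicProduct D n →
              T * ((6 * n + 2) * (3 * n) ^ (3 * n)) * (d ^ 8) ^ n ≤ (3 * n) ! * (suc d ^ 8 * n) ^ n
    count-≤ {T} T≤ = begin
      T * (c * (3 * n) ^ (3 * n)) * (d ^ 8) ^ n
        ≡⟨ cong₂ (λ y z → T * (c * y) * z) base³ (trans (^-exponent-comm d 8 n) (eighth p)) ⟩
      T * (c * (A * (ν * ν * ν))) * (p⁶ * p * p)
        ≡⟨ solve 6 (λ T c A ν p⁶ p → T :* (c :* (A :* (ν :* ν :* ν))) :* (p⁶ :* p :* p) := ν :* ν :* p :* (T :* c :* A :* ν :* p⁶ :* p)) refl T c A ν p⁶ p ⟩
      ν * ν * p * (T * c * A * ν * p⁶ * p)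
        ≤⟨ *-monoˡ-≤ _ n²ⁿ*p≤ ⟩
      q * D ^ n * (T * c * A * ν * p⁶ * p)
        ≡⟨ solve 8 (λ q δ T c A ν p⁶ p → q :* δ :* (T :* c :* A :* ν :* p⁶ :* p) := T :* δ :* p⁶ :* (q :* c :* A :* ν :* p)) refl q (D ^ n) T c A ν p⁶ p ⟩
      T * D ^ n * p⁶ * (q * c * A * ν * p)
        ≤⟨ *-monoˡ-≤ _ (≤-trans (*-monoˡ-≤ p⁶ T≤) cubicProduct*p⁶≤) ⟩
      f * f * f * q⁶ * (q * c * A * ν * p)
        ≡⟨ solve 7 (λ φ q⁶ q c A ν p → φ :* q⁶ :* (q :* c :* A :* ν :* p) := A :* φ :* (q⁶ :* q :* c :* ν :* p)) refl (f * f * f) q⁶ q c A ν p ⟩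
      A * (f * f * f) * (q⁶ * q * c * ν * p)
        ≤⟨ *-monoˡ-≤ _ 27ⁿ*f³≤ ⟩
      5 * n * F * (q⁶ * q * c * ν * p)
        ≡⟨ solve 7 (λ m F q⁶ q c ν p → m :* F :* (q⁶ :* q :* c :* ν :* p) := c :* m :* p :* (F :* (q⁶ :* q :* ν))) refl (5 * n) F q⁶ q c ν p ⟩
      c * (5 * n) * p * (F * (q⁶ * q * ν))
        ≤⟨ *-monoˡ-≤ _ polynomial≤ ⟩
      q * (F * (q⁶ * q * ν))
        ≡⟨ solve 4 (λ q F q⁶ ν → q :* (F :* (q⁶ :* q :* ν)) := F :* (q⁶ :* q :* q :* ν)) refl q F q⁶ ν ⟩
      F * (q⁶ * q * q * ν)
        ≡⟨ cong (λ z → F * (z * ν)) (trans (^-exponent-comm (suc d) 8 n) (eighth q)) ⟨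
      F * ((suc d ^ 8) ^ n * ν)
        ≡⟨ cong (F *_) (^-distribʳ-* (suc d ^ 8) n n) ⟨
      F * (suc d ^ 8 * n) ^ n ∎
      where
      open ≤-Reasoning
      c A ν F p⁶ q⁶ : ℕ
      c = 6 * n + 2
      A = 27 ^ n
      ν = n ^ n
      F = (3 * n) !
      p⁶ = p * p * (p * p) * (p * p)
      q⁶ = q * q * (q * q) * (q * q)
      eighth : ∀ x → x ^ 8 ≡ x * x * (x * x) * (x * x) * x * x
      eighth = solve 1 (λ x → x :* (x :* (x :* (x :* (x :* (x :* (x :* (x :* con 1))))))) := x :* x :* (x :* x) :* (x :* x) :* x :* x) refl
      cube : ∀ x → x ^ 3 ≡ x * x * x
      cube = solve 1 (λ x → x :* (x :* (x :* con 1)) := x :* x :* x) refl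
      base³ : (3 * n) ^ (3 * n) ≡ A * (ν * ν * ν)
      base³ = trans (sym (^-*-assoc (3 * n) 3 n)) (trans (cong (_^ n) (^-distribʳ-* 3 n 3))
        (trans (^-distribʳ-* 27 (n ^ 3) n) (cong (A *_) (trans (^-exponent-comm n 3 n) (cube ν)))))

-- Order and arithmetic of the rationals.

module WeightedCounting where

  open import Data.Rational
  open import Data.Rational.Properties
  open import Data.Rational.Solver using (module +-*-Solver)
  open import Algebra.Bundles using (CommutativeRing)
  open import Algebra.Properties.Semiring.Sum (CommutativeRing.semiring +-*-commutativeRing)
  open +-*-Solver
  open NaturalBounds using (falling₃; cubicProduct)

  toℚᵘ-ℕ→ℚ : ∀ m → toℚᵘ (ℕ→ℚ m) ℚᵘ.≃ ℚᵘ.mkℚᵘ (ℤ.+ m) 0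
  toℚᵘ-ℕ→ℚ m = toℚᵘ-fromℚᵘ (ℚᵘ.mkℚᵘ (ℤ.+ m) 0)

  ℕ→ℚ-+ : ∀ a b → ℕ→ℚ (a ℕ.+ b) ≡ ℕ→ℚ a + ℕ→ℚ b
  ℕ→ℚ-+ a b = toℚᵘ-injective (begin
    toℚᵘ (ℕ→ℚ (a ℕ.+ b))                    ≈⟨ toℚᵘ-ℕ→ℚ (a ℕ.+ b) ⟩
    ℚᵘ.mkℚᵘ (ℤ.+ (a ℕ.+ b)) 0                 ≈⟨ ℚᵘ.*≡* (cong (ℤ._* (ℤ.+ 1)) (sym (cong₂ ℤ._+_ (ℤₚ.*-identityʳ (ℤ.+ a)) (ℤₚ.*-identityʳ (ℤ.+ b))))) ⟩
    ℚᵘ.mkℚᵘ (ℤ.+ a) 0 ℚᵘ.+ ℚᵘ.mkℚᵘ (ℤ.+ b) 0    ≈⟨ ℚᵘₚ.+-cong (toℚᵘ-ℕ→ℚ a) (toℚᵘ-ℕ→ℚ b) ⟨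
    toℚᵘ (ℕ→ℚ a) ℚᵘ.+ toℚᵘ (ℕ→ℚ b)          ≈⟨ toℚᵘ-homo-+ (ℕ→ℚ a) (ℕ→ℚ b) ⟨
    toℚᵘ (ℕ→ℚ a + ℕ→ℚ b)                    ∎)
    where open ℚᵘₚ.≃-Reasoning

  ℕ→ℚ-* : ∀ a b → ℕ→ℚ (a ℕ.* b) ≡ ℕ→ℚ a * ℕ→ℚ b
  ℕ→ℚ-* a b = toℚᵘ-injective (begin
    toℚᵘ (ℕ→ℚ (a ℕ.* b))                    ≈⟨ toℚᵘ-ℕ→ℚ (a ℕ.* b) ⟩
    ℚᵘ.mkℚᵘ (ℤ.+ (a ℕ.* b)) 0                 ≈⟨ ℚᵘ.*≡* (cong (ℤ._* (ℤ.+ 1)) (ℤₚ.pos-* a b)) ⟩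
    ℚᵘ.mkℚᵘ (ℤ.+ a) 0 ℚᵘ.* ℚᵘ.mkℚᵘ (ℤ.+ b) 0    ≈⟨ ℚᵘₚ.*-cong (toℚᵘ-ℕ→ℚ a) (toℚᵘ-ℕ→ℚ b) ⟨
    toℚᵘ (ℕ→ℚ a) ℚᵘ.* toℚᵘ (ℕ→ℚ b)          ≈⟨ toℚᵘ-homo-* (ℕ→ℚ a) (ℕ→ℚ b) ⟨
    toℚᵘ (ℕ→ℚ a * ℕ→ℚ b)                    ∎)
    where open ℚᵘₚ.≃-Reasoning

  ℕ→ℚ-suc : ∀ m → ℕ→ℚ (suc m) ≡ 1ℚ + ℕ→ℚ m
  ℕ→ℚ-suc m = ℕ→ℚ-+ 1 m

  ℕ→ℚ-mono-≤ : ∀ {a b} → a ℕ.≤ b → ℕ→ℚ a ≤ ℕ→ℚ b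
  ℕ→ℚ-mono-≤ {a} {b} a≤b = toℚᵘ-cancel-≤ (begin
    toℚᵘ (ℕ→ℚ a)     ≃⟨ toℚᵘ-ℕ→ℚ a ⟩
    ℚᵘ.mkℚᵘ (ℤ.+ a) 0  ≤⟨ ℚᵘ.*≤* (ℤₚ.*-monoʳ-≤-nonNeg (ℤ.+ 1) (ℤ.+≤+ a≤b)) ⟩
    ℚᵘ.mkℚᵘ (ℤ.+ b) 0  ≃⟨ toℚᵘ-ℕ→ℚ b ⟨
    toℚᵘ (ℕ→ℚ b)     ∎)
    where open ℚᵘₚ.≤-Reasoning

  ℕ→ℚ-nonNeg : ∀ m → 0ℚ ≤ ℕ→ℚ m
  ℕ→ℚ-nonNeg m = ℕ→ℚ-mono-≤ (ℕ.z≤n {m})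

  *ˡ-mono-≤ : ∀ {r p q} → 0ℚ ≤ r → p ≤ q → r * p ≤ r * q
  *ˡ-mono-≤ {r} 0≤r = *-monoˡ-≤-nonNeg r {{nonNegative 0≤r}}

  *ʳ-mono-≤ : ∀ {r p q} → 0ℚ ≤ r → p ≤ q → p * r ≤ q * r
  *ʳ-mono-≤ {r} 0≤r = *-monoʳ-≤-nonNeg r {{nonNegative 0≤r}}

  *-nonNeg : ∀ {p q} → 0ℚ ≤ p → 0ℚ ≤ q → 0ℚ ≤ p * q
  *-nonNeg {p} {q} 0≤p 0≤q = nonNegative⁻¹ (p * q) {{nonNeg*nonNeg⇒nonNeg p {{nonNegative 0≤p}} q {{nonNegative 0≤q}}}}

  +-nonNeg : ∀ {p q} → 0ℚ ≤ p → 0ℚ ≤ q → 0ℚ ≤ p + q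
  +-nonNeg {p} {q} = +-mono-≤ {0ℚ} {p} {0ℚ} {q}

  *-mono₂-≤ : ∀ {p q r s} → 0ℚ ≤ p → 0ℚ ≤ s → p ≤ q → r ≤ s → p * r ≤ q * s
  *-mono₂-≤ 0≤p 0≤s p≤q r≤s = ≤-trans (*ˡ-mono-≤ 0≤p r≤s) (*ʳ-mono-≤ 0≤s p≤q)

  -- Total, with value 0 at 0, so that weights are defined for arbitrary maps x; positivity is asked
  -- for only where the inverse is cancelled.
  inv : ℚ → ℚ
  inv p with p ≟ 0ℚ
  ... | yes _   = 0ℚ
  ... | no p≢0 = (1/ p) {{≢-nonZero p≢0}}

  *-inv : ∀ {p} → 0ℚ < p → p * inv p ≡ 1ℚ
  *-inv {p} 0<p with p ≟ 0ℚ
  ... | yes p≡0 = contradiction (sym p≡0) (<⇒≢ 0<p)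
  ... | no p≢0  = *-inverseʳ p {{≢-nonZero p≢0}}

  inv-nonNeg : ∀ {p} → 0ℚ ≤ p → 0ℚ ≤ inv p
  inv-nonNeg {p} 0≤p with p ≟ 0ℚ
  ... | yes _   = ≤-refl
  ... | no p≢0 = <⇒≤ (positive⁻¹ ((1/ p) {{pos⇒nonZero p {{p-pos}}}}) {{1/pos⇒pos p {{p-pos}}}})
    where
    p-pos : Positive p
    p-pos = nonNeg∧nonZero⇒pos p {{nonNegative 0≤p}} {{≢-nonZero p≢0}}

  0<ℕ→ℚ-suc : ∀ m → 0ℚ < ℕ→ℚ (suc m)
  0<ℕ→ℚ-suc m = <-≤-trans (positive⁻¹ 1ℚ) (ℕ→ℚ-mono-≤ (ℕ.s≤s (ℕ.z≤n {m})))

  sum-mono-≤ : ∀ {n} {f g : Fin n → ℚ} → (∀ i → f i ≤ g i) → sum f ≤ sum g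
  sum-mono-≤ {zero}  f≤g = ≤-refl
  sum-mono-≤ {suc n} f≤g = +-mono-≤ (f≤g zero) (sum-mono-≤ (f≤g ∘ suc))

  ^ℚ-nonNeg : ∀ {p} k → 0ℚ ≤ p → 0ℚ ≤ p ^ℚ k
  ^ℚ-nonNeg zero    0≤p = ℕ→ℚ-nonNeg 1
  ^ℚ-nonNeg (suc k) 0≤p = *-nonNeg 0≤p (^ℚ-nonNeg k 0≤p)

  ^ℚ-mono-≤ : ∀ {p q} k → 0ℚ ≤ p → p ≤ q → p ^ℚ k ≤ q ^ℚ k
  ^ℚ-mono-≤ zero    0≤p p≤q = ≤-refl
  ^ℚ-mono-≤ (suc k) 0≤p p≤q =
    *-mono₂-≤ 0≤p (^ℚ-nonNeg k (≤-trans 0≤p p≤q)) p≤q (^ℚ-mono-≤ k 0≤p p≤q)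

  p≤q⇒0≤q-p : ∀ {p q} → p ≤ q → 0ℚ ≤ q - p
  p≤q⇒0≤q-p {p} {q} p≤q = begin
    0ℚ     ≡⟨ +-inverseʳ p ⟨
    p - p  ≤⟨ +-monoˡ-≤ (- p) p≤q ⟩
    q - p  ∎
    where open ≤-Reasoning

  0≤q-p⇒p≤q : ∀ {p q} → 0ℚ ≤ q - p → p ≤ q
  0≤q-p⇒p≤q {p} {q} 0≤q-p = begin
    p            ≡⟨ +-identityʳ p ⟨
    p + 0ℚ       ≤⟨ +-monoʳ-≤ p 0≤q-p ⟩
    p + (q - p)  ≡⟨ solve 2 (λ p q → p :+ (q :- p) := q) refl p q ⟩
    q            ∎
    where open ≤-Reasoning

  -- AM-GM over the rationals.

  rearrangement : ∀ {a b c d} → a ≤ b → c ≤ d → a * d + b * c ≤ a * c + b * d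
  rearrangement {a} {b} {c} {d} a≤b c≤d = 0≤q-p⇒p≤q (begin
    0ℚ                                 ≤⟨ *-nonNeg (p≤q⇒0≤q-p a≤b) (p≤q⇒0≤q-p c≤d) ⟩
    (b - a) * (d - c)                  ≡⟨ solve 4 (λ a b c d → (b :- a) :* (d :- c) := (a :* c :+ b :* d) :- (a :* d :+ b :* c)) refl a b c d ⟩
    (a * c + b * d) - (a * d + b * c)  ∎)
    where open ≤-Reasoning

  rearrangement-^ : ∀ {a b} k → 0ℚ ≤ a → 0ℚ ≤ b → a * b ^ℚ k + b * a ^ℚ k ≤ a * a ^ℚ k + b * b ^ℚ k
  rearrangement-^ {a} {b} k 0≤a 0≤b with ≤-total a b
  ... | inj₁ a≤b = rearrangement a≤b (^ℚ-mono-≤ k 0≤a a≤b)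
  ... | inj₂ b≤a = begin
    a * b ^ℚ k + b * a ^ℚ k  ≡⟨ +-comm (a * b ^ℚ k) _ ⟩
    b * a ^ℚ k + a * b ^ℚ k  ≤⟨ rearrangement b≤a (^ℚ-mono-≤ k 0≤b b≤a) ⟩
    b * b ^ℚ k + a * a ^ℚ k  ≡⟨ +-comm (b * b ^ℚ k) _ ⟩
    a * a ^ℚ k + b * b ^ℚ k  ∎
    where open ≤-Reasoning

  -- AM-GM for one a and k copies of b. Multiplying case k by b leaves the mixed terms a · b^(k+1)
  -- and b · a^(k+1), which rearrangement turns into pure powers.
  young : ∀ {a b} k → 0ℚ ≤ a → 0ℚ ≤ b → ℕ→ℚ (suc k) * a * b ^ℚ k ≤ a ^ℚ suc k + ℕ→ℚ k * b ^ℚ suc k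
  young {a} {b} zero 0≤a 0≤b = ≤-reflexive (solve 2 (λ a b → con 1ℚ :* a :* con 1ℚ := a :* con 1ℚ :+ con 0ℚ :* (b :* con 1ℚ)) refl a b)
  young {a} {b} (suc k) 0≤a 0≤b = begin
    ℕ→ℚ (suc (suc k)) * a * (b * B)            ≡⟨ cong (λ z → z * a * (b * B)) (ℕ→ℚ-suc (suc k)) ⟩
    (1ℚ + s) * a * (b * B)                     ≡⟨ solve 4 (λ a b s B → (con 1ℚ :+ s) :* a :* (b :* B) := a :* (b :* B) :+ b :* (s :* a :* B)) refl a b s B ⟩
    a * (b * B) + b * (s * a * B)              ≤⟨ +-monoʳ-≤ (a * (b * B)) (*ˡ-mono-≤ 0≤b (young k 0≤a 0≤b)) ⟩
    a * (b * B) + b * (a * A + ι * (b * B))    ≡⟨ solve 5 (λ a b A B ι → a :* (b :* B) :+ b :* (a :* A :+ ι :* (b :* B)) := (a :* (b :* B) :+ b :* (a :* A)) :+ ι :* (b :* (b :* B))) refl a b A B ι ⟩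
    (a * (b * B) + b * (a * A)) + ι * (b * (b * B))   ≤⟨ +-monoˡ-≤ (ι * (b * (b * B))) (rearrangement-^ (suc k) 0≤a 0≤b) ⟩
    (a * (a * A) + b * (b * B)) + ι * (b * (b * B))   ≡⟨ solve 4 (λ a A y ι → (a :* (a :* A) :+ y) :+ ι :* y := a :* (a :* A) :+ (con 1ℚ :+ ι) :* y) refl a A (b * (b * B)) ι ⟩
    a * (a * A) + (1ℚ + ι) * (b * (b * B))     ≡⟨ cong (λ z → a * (a * A) + z * (b * (b * B))) (ℕ→ℚ-suc k) ⟨
    a * (a * A) + s * (b * (b * B))            ∎
    where
    open ≤-Reasoning
    s ι A B : ℚ
    s = ℕ→ℚ (suc k)
    ι = ℕ→ℚ k
    A = a ^ℚ k
    B = b ^ℚ k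

  sumL prodL : List ℚ → ℚ
  sumL  = foldr _+_ 0ℚ
  prodL = foldr _*_ 1ℚ

  sumL-nonNeg : ∀ {xs} → All (0ℚ ≤_) xs → 0ℚ ≤ sumL xs
  sumL-nonNeg []         = ≤-refl
  sumL-nonNeg (0≤x ∷ xs) = +-nonNeg 0≤x (sumL-nonNeg xs)

  -- If the tail of length k has mean ν, then x = (k + 1)μ - kν, and x · ν^k ≤ μ^(k+1) is `young` at
  -- μ and ν. No roots are taken.
  am-gm : ∀ {xs μ} → All (0ℚ ≤_) xs → 0ℚ ≤ μ → sumL xs ≡ ℕ→ℚ (length xs) * μ → prodL xs ≤ μ ^ℚ length xs
  am-gm []                              0≤μ _  = ≤-refl
  -- A singleton is separate because the mean of an empty tail would divide by 0.
  am-gm {x ∷ []}     {μ} (0≤x ∷ [])     0≤μ eq = ≤-reflexive (cong (_* 1ℚ) (begin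
    x        ≡⟨ +-identityʳ x ⟨
    x + 0ℚ   ≡⟨ eq ⟩
    1ℚ * μ   ≡⟨ *-identityˡ μ ⟩
    μ        ∎))
    where open ≡-Reasoning
  am-gm {x ∷ xs@(_ ∷ ys)} {μ} (0≤x ∷ 0≤xs) 0≤μ eq = begin
    x * prodL xs                      ≤⟨ *ˡ-mono-≤ 0≤x (am-gm 0≤xs 0≤ν eq′) ⟩
    x * N                             ≡⟨ cong (_* N) x≡ ⟩
    (ℕ→ℚ (suc k) * μ - ι * ν) * N     ≡⟨ solve 5 (λ j μ ι ν N → (j :* μ :- ι :* ν) :* N := j :* μ :* N :- ι :* (ν :* N)) refl (ℕ→ℚ (suc k)) μ ι ν N ⟩
    ℕ→ℚ (suc k) * μ * N - ι * (ν * N) ≤⟨ +-monoˡ-≤ (- (ι * (ν * N))) (young k 0≤μ 0≤ν) ⟩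
    (μ ^ℚ suc k + ι * (ν * N)) - ι * (ν * N) ≡⟨ solve 2 (λ a b → (a :+ b) :- b := a) refl (μ ^ℚ suc k) (ι * (ν * N)) ⟩
    μ ^ℚ suc k                        ∎
    where
    open ≤-Reasoning
    k : ℕ
    k = length xs
    ι ν N : ℚ
    ι = ℕ→ℚ k
    ν = inv ι * sumL xs
    N = ν ^ℚ k
    0≤ν : 0ℚ ≤ ν
    0≤ν = *-nonNeg (inv-nonNeg (ℕ→ℚ-nonNeg k)) (sumL-nonNeg 0≤xs)
    eq′ : sumL xs ≡ ι * ν
    eq′ = trans (sym (*-identityˡ (sumL xs))) (trans (cong (_* sumL xs) (sym (*-inv (0<ℕ→ℚ-suc (length ys))))) (*-assoc ι (inv ι) (sumL xs)))
    x≡ : x ≡ ℕ→ℚ (suc k) * μ - ι * ν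
    x≡ = trans (solve 2 (λ x s → x := (x :+ s) :- s) refl x (sumL xs)) (cong₂ _-_ eq eq′)

  1^ℚ : ∀ k → 1ℚ ^ℚ k ≡ 1ℚ
  1^ℚ zero    = refl
  1^ℚ (suc k) = trans (*-identityˡ (1ℚ ^ℚ k)) (1^ℚ k)

  -- AM–GM for xs together with the entry that raises their mean to 1.
  inverse-prod-tangent : ∀ {xs p} → All (0ℚ ≤_) xs → 0ℚ ≤ p → p * prodL xs ≡ 1ℚ →
                         ℕ→ℚ (suc (length xs)) - sumL xs ≤ p
  inverse-prod-tangent {xs} {p} 0≤xs 0≤p eq with ≤-total (ℕ→ℚ (suc (length xs)) - sumL xs) 0ℚ
  ... | inj₁ t≤0 = ≤-trans t≤0 0≤p
  ... | inj₂ 0≤t = begin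
    t                  ≡⟨ *-identityˡ t ⟨
    1ℚ * t             ≡⟨ cong (_* t) eq ⟨
    p * prodL xs * t   ≡⟨ solve 3 (λ p x t → p :* x :* t := p :* (t :* x)) refl p (prodL xs) t ⟩
    p * (t * prodL xs) ≤⟨ *ˡ-mono-≤ 0≤p (am-gm {t ∷ xs} {1ℚ} (0≤t ∷ 0≤xs) (ℕ→ℚ-nonNeg 1) mean) ⟩
    p * 1ℚ ^ℚ suc k    ≡⟨ cong (p *_) (1^ℚ (suc k)) ⟩
    p * 1ℚ             ≡⟨ *-identityʳ p ⟩
    p                  ∎
    where
    open ≤-Reasoning
    k = length xs
    t = ℕ→ℚ (suc k) - sumL xs
    mean : t + sumL xs ≡ ℕ→ℚ (suc k) * 1ℚ
    mean = solve 2 (λ a s → (a :- s) :+ s := a :* con 1ℚ) refl (ℕ→ℚ (suc k)) (sumL xs)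

  -- Indicators, sums over lists and cardinalities of row sets.

  0≤1 : 0ℚ ≤ 1ℚ
  0≤1 = ℕ→ℚ-nonNeg 1

  𝟙 : Bool → ℚ
  𝟙 true  = 1ℚ
  𝟙 false = 0ℚ

  𝟙-nonNeg : ∀ b → 0ℚ ≤ 𝟙 b
  𝟙-nonNeg true  = 0≤1
  𝟙-nonNeg false = ≤-refl

  𝟙-mono-*-≤ : ∀ b {p q} → (b ≡ true → p ≤ q) → 𝟙 b * p ≤ 𝟙 b * q
  𝟙-mono-*-≤ true          p≤q = *ˡ-mono-≤ 0≤1 (p≤q refl)
  𝟙-mono-*-≤ false {p} {q} p≤q = ≤-reflexive (trans (*-zeroˡ p) (sym (*-zeroˡ q)))

  δ : ∀ {n} → Fin n → Fin n → ℚ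
  δ i j = 𝟙 (does (i Fin.≟ j))

  δ-≢ : ∀ {n} {i j : Fin n} → i ≢ j → δ i j ≡ 0ℚ
  δ-≢ {i = i} {j} i≢j = cong 𝟙 (dec-false (i Fin.≟ j) i≢j)

  sum-zero : ∀ {n} {f : Fin n → ℚ} → (∀ i → f i ≡ 0ℚ) → sum f ≡ 0ℚ
  sum-zero {n} f≡0 = trans (sum-cong-≗ f≡0) (sum-replicate-zero n)

  sum-δ : ∀ {n} (i : Fin n) → sum (δ i) ≡ 1ℚ
  sum-δ {suc n} zero    = trans (cong (1ℚ +_) (sum-zero {n} λ _ → refl)) (+-identityʳ 1ℚ)
  sum-δ {suc n} (suc i) = trans (+-identityˡ (sum (δ i))) (sum-δ i)

  sum-nonNeg : ∀ {n} {f : Fin n → ℚ} → (∀ i → 0ℚ ≤ f i) → 0ℚ ≤ sum f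
  sum-nonNeg {n} {f} 0≤f = ≤-trans (≤-reflexive (sym (sum-replicate-zero n))) (sum-mono-≤ 0≤f)

  term-≤-sum : ∀ {n} {f : Fin n → ℚ} → (∀ i → 0ℚ ≤ f i) → ∀ i → f i ≤ sum f
  term-≤-sum {suc n} {f} 0≤f zero    = ≤-trans (≤-reflexive (sym (+-identityʳ (f zero)))) (+-monoʳ-≤ (f zero) (sum-nonNeg (0≤f ∘ suc)))
  term-≤-sum {suc n} {f} 0≤f (suc i) = ≤-trans (≤-reflexive (sym (+-identityˡ _))) (+-mono-≤ (0≤f zero) (term-≤-sum (0≤f ∘ suc) i))

  sumOver : ∀ {A : Set} → List A → (A → ℚ) → ℚ
  sumOver []       f = 0ℚ
  sumOver (x ∷ xs) f = f x + sumOver xs f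

  module _ {A : Set} where

    sumOver-cong : ∀ {f g : A → ℚ} xs → (∀ {x} → x ∈ xs → f x ≡ g x) → sumOver xs f ≡ sumOver xs g
    sumOver-cong []       f≡g = refl
    sumOver-cong (x ∷ xs) f≡g = cong₂ _+_ (f≡g (here refl)) (sumOver-cong xs (f≡g ∘ there))

    sumOver-*ˡ : ∀ c (f : A → ℚ) xs → sumOver xs (λ x → c * f x) ≡ c * sumOver xs f
    sumOver-*ˡ c f []       = sym (*-zeroʳ c)
    sumOver-*ˡ c f (x ∷ xs) = trans (cong (c * f x +_) (sumOver-*ˡ c f xs)) (sym (*-distribˡ-+ c (f x) _))

    sumOver-sum : ∀ {n} (f : A → Fin n → ℚ) xs → sumOver xs (λ x → sum (f x)) ≡ sum (λ i → sumOver xs (λ x → f x i))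
    sumOver-sum {n} f []       = sym (sum-replicate-zero n)
    sumOver-sum {n} f (x ∷ xs) = trans (cong (sum (f x) +_) (sumOver-sum f xs)) (sym (∑-distrib-+ (f x) _))

    sumOver-fibres : ∀ {n} (g : A → Fin n) (f : A → ℚ) xs →
                     sumOver xs f ≡ sum (λ y → sumOver (filter (λ x → g x Fin.≟ y) xs) f)
    sumOver-fibres {n} g f []       = sym (sum-replicate-zero n)
    sumOver-fibres {n} g f (x ∷ xs) = begin
      f x + sumOver xs f                                      ≡⟨ cong₂ _+_ (sym fx) (sumOver-fibres g f xs) ⟩
      sum (λ y → f x * δ (g x) y) + sum (λ y → fib y xs)      ≡⟨ ∑-distrib-+ (λ y → f x * δ (g x) y) _ ⟨
      sum (λ y → f x * δ (g x) y + fib y xs)                  ≡⟨ sum-cong-≗ step ⟩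
      sum (λ y → fib y (x ∷ xs))                              ∎
      where
      open ≡-Reasoning
      fib : Fin n → List A → ℚ
      fib y ys = sumOver (filter (λ x → g x Fin.≟ y) ys) f
      fx : sum (λ y → f x * δ (g x) y) ≡ f x
      fx = trans (sym (*-distribˡ-sum (f x) (δ (g x)))) (trans (cong (f x *_) (sum-δ (g x))) (*-identityʳ (f x)))
      step : ∀ y → f x * δ (g x) y + fib y xs ≡ fib y (x ∷ xs)
      step y with g x Fin.≟ y
      ... | yes _ = cong (_+ fib y xs) (*-identityʳ (f x))
      ... | no _  = trans (cong (_+ fib y xs) (*-zeroʳ (f x))) (+-identityˡ _)

  infixl 6 _-ʳ_
  _-ʳ_ : ∀ {n} → (Fin n → Bool) → Fin n → (Fin n → Bool)
  (R -ʳ i) j = R j ∧ not (does (i Fin.≟ j))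

  -ʳ-self : ∀ {n} (R : Fin n → Bool) i → (R -ʳ i) i ≡ false
  -ʳ-self R i rewrite dec-true (i Fin.≟ i) refl = ∧-zeroʳ (R i)

  -ʳ-≢ : ∀ {n} (R : Fin n → Bool) {i j} → i ≢ j → (R -ʳ i) j ≡ R j
  -ʳ-≢ R {i} {j} i≢j rewrite dec-false (i Fin.≟ j) i≢j = ∧-identityʳ (R j)

  card : ∀ {n} → (Fin n → Bool) → ℚ
  card R = sum (𝟙 ∘ R)

  card-ʳ : ∀ {n} (R : Fin n → Bool) {i} m → R i ≡ true → card R ≡ ℕ→ℚ (suc m) → card (R -ʳ i) ≡ ℕ→ℚ m
  card-ʳ {n} R {i} m Ri eq = begin
    card (R -ʳ i)                         ≡⟨ solve 1 (λ c → c := (c :+ con 1ℚ) :- con 1ℚ) refl (card (R -ʳ i)) ⟩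
    (card (R -ʳ i) + 1ℚ) - 1ℚ             ≡⟨ cong (λ z → (card (R -ʳ i) + z) - 1ℚ) (sym (sum-δ i)) ⟩
    (card (R -ʳ i) + sum (δ i)) - 1ℚ      ≡⟨ cong (_- 1ℚ) (sym (∑-distrib-+ (𝟙 ∘ (R -ʳ i)) (δ i))) ⟩
    sum (λ j → 𝟙 ((R -ʳ i) j) + δ i j) - 1ℚ  ≡⟨ cong (_- 1ℚ) (sum-cong-≗ step) ⟩
    card R - 1ℚ                           ≡⟨ cong (_- 1ℚ) (trans eq (ℕ→ℚ-suc m)) ⟩
    (1ℚ + ℕ→ℚ m) - 1ℚ                     ≡⟨ solve 1 (λ c → (con 1ℚ :+ c) :- con 1ℚ := c) refl (ℕ→ℚ m) ⟩
    ℕ→ℚ m                                 ∎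
    where
    open ≡-Reasoning
    step : ∀ j → 𝟙 ((R -ʳ i) j) + δ i j ≡ 𝟙 (R j)
    step j with i Fin.≟ j
    ... | yes refl rewrite Ri = refl
    ... | no _ with R j
    ...   | true  = refl
    ...   | false = refl

  card-zero : ∀ {n} (R : Fin n → Bool) → card R ≡ 0ℚ → ∀ i → R i ≡ false
  card-zero R eq i with R i in Ri
  ... | false = refl
  ... | true  = contradiction refl (<⇒≢ (<-≤-trans (positive⁻¹ 1ℚ)
    (subst₂ _≤_ (cong 𝟙 Ri) eq (term-≤-sum {f = 𝟙 ∘ R} (𝟙-nonNeg ∘ R) i))))

  sum-𝟙-average : ∀ {n} (R : Fin n → Bool) m → card R ≡ ℕ→ℚ (suc m) → ∀ c →
                  sum (λ i → 𝟙 (R i) * (inv (ℕ→ℚ (suc m)) * c)) ≡ c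
  sum-𝟙-average R m cR c = begin
    sum (λ i → 𝟙 (R i) * (r * c))  ≡⟨ *-distribʳ-sum (r * c) (𝟙 ∘ R) ⟨
    card R * (r * c)               ≡⟨ *-assoc (card R) r c ⟨
    card R * r * c                 ≡⟨ cong (λ z → z * r * c) cR ⟩
    ℕ→ℚ (suc m) * r * c            ≡⟨ cong (_* c) (*-inv (0<ℕ→ℚ-suc m)) ⟩
    1ℚ * c                         ≡⟨ *-identityˡ c ⟩
    c                              ∎
    where
    open ≡-Reasoning
    r : ℚ
    r = inv (ℕ→ℚ (suc m))

  -- Greedy revelation: the total weight of all configurations.

  module Greedy {n} (ℓ : Fin 3 → Fin n → Fin n → Fin n) (a : ℕ → ℚ) (0≤a : ∀ m → 0ℚ ≤ a m) where

    Valid : (Fin n → Fin n) → Set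
    Valid x = ∀ c {i j} → ℓ c i (x i) ≡ ℓ c j (x j) → i ≡ j

    -- `R` holds the unrevealed rows, so `R j ≡ false` says that the queen of row j is already
    -- visible.
    Free : (Fin n → Bool) → (Fin n → Fin n) → Fin n → Fin n → Set
    Free R x i y = ∀ j → R j ≡ false → ∀ c → ℓ c j (x j) ≢ ℓ c i y

    abstract
      free? : ∀ R x i y → Dec (Free R x i y)
      free? R x i y = all? λ j → (R j Bool.≟ false) →-dec all? λ c → ¬? (ℓ c j (x j) Fin.≟ ℓ c i y)

    freeCount : (Fin n → Bool) → (Fin n → Fin n) → Fin n → ℚ
    freeCount R x i = sum (λ y → 𝟙 (does (free? R x i y)))

    -- The mean over all orders of R of ∏ aⱼ / Nⱼ, where Nⱼ counts the columns free for the row chosen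
    -- when j rows are left.
    weight : ℕ → (Fin n → Bool) → (Fin n → Fin n) → ℚ
    weight zero    R x = 1ℚ
    weight (suc m) R x = sum λ i → 𝟙 (R i) *
      (inv (ℕ→ℚ (suc m)) * (a (suc m) * inv (freeCount R x i) * weight m (R -ʳ i) x))

    bound : ℕ → ℚ
    bound zero    = 1ℚ
    bound (suc m) = a (suc m) * bound m

    bound-nonNeg : ∀ m → 0ℚ ≤ bound m
    bound-nonNeg zero    = 0≤1
    bound-nonNeg (suc m) = *-nonNeg (0≤a (suc m)) (bound-nonNeg m)

    free-cong : ∀ R {x x′} i y → (∀ j → R j ≡ false → x j ≡ x′ j) → Free R x i y → Free R x′ i y
    free-cong R i y x≡x′ free j Rj c eq = free j Rj c (trans (cong (ℓ c j) (x≡x′ j Rj)) eq)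

    -- `Free` consults x at revealed rows only. Hence the free count is common to all configurations
    -- that agree so far and can leave the sum over them.
    freeCount-cong : ∀ R {x x′} i → (∀ j → R j ≡ false → x j ≡ x′ j) → freeCount R x i ≡ freeCount R x′ i
    freeCount-cong R i x≡x′ = sum-cong-≗ λ y → cong 𝟙 (does-⇔
      (mk⇔ (free-cong R i y x≡x′) (free-cong R i y (λ j Rj → sym (x≡x′ j Rj)))) (free? R _ i y) (free? R _ i y))

    free-own : ∀ R {x} i → R i ≡ true → Valid x → Free R x i (x i)
    free-own R i Ri valid j Rj c eq with valid c {j} {i} eq
    ... | refl = contradiction (trans (sym Ri) Rj) λ ()

    1≤freeCount : ∀ R {x} i → R i ≡ true → Valid x → 1ℚ ≤ freeCount R x i
    1≤freeCount R {x} i Ri valid = subst (_≤ freeCount R x i)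
      (cong 𝟙 (dec-true (free? R x i (x i)) (free-own R i Ri valid)))
      (term-≤-sum (λ y → 𝟙-nonNeg (does (free? R x i y))) (x i))

    0<freeCount : ∀ R {x} i → R i ≡ true → Valid x → 0ℚ < freeCount R x i
    0<freeCount R i Ri valid = <-≤-trans (positive⁻¹ 1ℚ) (1≤freeCount R i Ri valid)

    -- The conditional form of "greedy probabilities sum to at most 1", for the configurations
    -- compatible with what is revealed. For a fixed next row i, split `S` by the column of that
    -- row: only the N free columns have nonempty fibres, each fibre contributes at most `bound m`
    -- by induction, and N cancels against the factor 1/N. The average over i preserves the bound.
    sum-weight-≤ : ∀ m R (S : List (Vec (Fin n) n)) → card R ≡ ℕ→ℚ m → Unique S →
                   (∀ {v} → v ∈ S → Valid (lookup v)) →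
                   (∀ {v w} → v ∈ S → w ∈ S → ∀ j → R j ≡ false → lookup v j ≡ lookup w j) →
                   sumOver S (weight m R ∘ lookup) ≤ bound m
    sum-weight-≤ zero R [] cR uniq valid agree = 0≤1
    sum-weight-≤ zero R (v ∷ []) cR uniq valid agree = ≤-refl
    -- With no row left, agreement on revealed rows is equality, so two distinct members are
    -- impossible.
    sum-weight-≤ zero R (v ∷ w ∷ S) cR ((v≢w ∷ _) ∷ _) valid agree = contradiction
      (trans (sym (tabulate∘lookup v)) (trans (tabulate-cong λ j → agree (here refl) (there (here refl)) j (card-zero R cR j)) (tabulate∘lookup w))) v≢w
    sum-weight-≤ (suc m) R [] cR uniq valid agree = bound-nonNeg (suc m)
    -- The head `v₀` serves as the reference whose free counts stand for those of every member of
    -- `S`.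
    sum-weight-≤ (suc m) R S@(v₀ ∷ _) cR uniq valid agree = begin
      sumOver S (λ v → sum (λ i → 𝟙 (R i) * (r * (g v i * h v i))))   ≡⟨ sumOver-sum (λ v i → 𝟙 (R i) * (r * (g v i * h v i))) S ⟩
      sum (λ i → sumOver S (λ v → 𝟙 (R i) * (r * (g v i * h v i))))   ≤⟨ sum-mono-≤ row ⟩
      sum (λ i → 𝟙 (R i) * (r * bound (suc m)))                       ≡⟨ sum-𝟙-average R m cR (bound (suc m)) ⟩
      bound (suc m)                                                   ∎
      where
      open ≤-Reasoning
      r : ℚ
      r = inv (ℕ→ℚ (suc m))
      g h : Vec (Fin n) n → Fin n → ℚ
      g v i = a (suc m) * inv (freeCount R (lookup v) i)
      h v i = weight m (R -ʳ i) (lookup v)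
      v₀∈S : v₀ ∈ S
      v₀∈S = here refl

      fibre : ∀ i → R i ≡ true → ∀ y →
              sumOver (filter (λ v → lookup v i Fin.≟ y) S) (λ v → h v i) ≤ 𝟙 (does (free? R (lookup v₀) i y)) * bound m
      fibre i Ri y with free? R (lookup v₀) i y
      ... | yes _ = ≤-trans
        (sum-weight-≤ m (R -ʳ i) (filter (λ v → lookup v i Fin.≟ y) S) (card-ʳ R m Ri cR) (Uniqueₚ.filter⁺ (λ v → lookup v i Fin.≟ y) uniq)
           (λ v∈ → valid (proj₁ (∈-filter⁻ (λ v → lookup v i Fin.≟ y) v∈))) agree′)
        (≤-reflexive (sym (*-identityˡ (bound m))))
        where
        agree′ : ∀ {v w} → v ∈ filter (λ v → lookup v i Fin.≟ y) S → w ∈ filter (λ v → lookup v i Fin.≟ y) S →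
                 ∀ j → (R -ʳ i) j ≡ false → lookup v j ≡ lookup w j
        agree′ v∈ w∈ j Rj with ∈-filter⁻ (λ v → lookup v i Fin.≟ y) {xs = S} v∈ | ∈-filter⁻ (λ v → lookup v i Fin.≟ y) {xs = S} w∈ | i Fin.≟ j
        ... | v∈S , vi | w∈S , wi | yes refl = trans vi (sym wi)
        ... | v∈S , _ | w∈S , _ | no i≢j = agree v∈S w∈S j (trans (sym (∧-identityʳ (R j))) Rj)
      ... | no ¬free with filter (λ v → lookup v i Fin.≟ y) S in eq
      ...   | []    = ≤-reflexive (sym (*-zeroˡ (bound m)))
      -- A member of the fibre has its own cell in row i free and agrees with `v₀` on the revealed
      -- rows, so column y would be free after all.
      ...   | v ∷ _ with ∈-filter⁻ (λ v → lookup v i Fin.≟ y) {xs = S} (subst (v ∈_) (sym eq) (here refl))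
      ...     | v∈S , refl = contradiction (free-cong R i y (agree v∈S v₀∈S) (free-own R i Ri (valid v∈S))) ¬free

      row : ∀ i → sumOver S (λ v → 𝟙 (R i) * (r * (g v i * h v i))) ≤ 𝟙 (R i) * (r * bound (suc m))
      row i = begin
        sumOver S (λ v → 𝟙 (R i) * (r * (g v i * h v i)))      ≡⟨ sumOver-*ˡ (𝟙 (R i)) _ S ⟩
        𝟙 (R i) * sumOver S (λ v → r * (g v i * h v i))        ≡⟨ cong (𝟙 (R i) *_) (sumOver-*ˡ r _ S) ⟩
        𝟙 (R i) * (r * sumOver S (λ v → g v i * h v i))        ≤⟨ 𝟙-mono-*-≤ (R i) (λ Ri → *ˡ-mono-≤ (inv-nonNeg (ℕ→ℚ-nonNeg (suc m))) (inner Ri)) ⟩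
        𝟙 (R i) * (r * bound (suc m))                          ∎
        where
        N : ℚ
        N = freeCount R (lookup v₀) i
        inner : R i ≡ true → sumOver S (λ v → g v i * h v i) ≤ a (suc m) * bound m
        inner Ri = begin
          sumOver S (λ v → g v i * h v i)       ≡⟨ sumOver-cong S (λ v∈S → cong (λ z → a (suc m) * inv z * _) (freeCount-cong R i (agree v∈S v₀∈S))) ⟩
          sumOver S (λ v → g v₀ i * h v i)      ≡⟨ sumOver-*ˡ (g v₀ i) _ S ⟩
          g v₀ i * sumOver S (λ v → h v i)      ≡⟨ cong (g v₀ i *_) (sumOver-fibres (λ v → lookup v i) _ S) ⟩
          g v₀ i * sum (λ y → sumOver (filter (λ v → lookup v i Fin.≟ y) S) (λ v → h v i))
                                                ≤⟨ *ˡ-mono-≤ (*-nonNeg (0≤a (suc m)) (inv-nonNeg (<⇒≤ 0<N))) (sum-mono-≤ (fibre i Ri)) ⟩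
          g v₀ i * sum (λ y → 𝟙 (does (free? R (lookup v₀) i y)) * bound m)
                                                ≡⟨ cong (g v₀ i *_) (sym (*-distribʳ-sum (bound m) (λ y → 𝟙 (does (free? R (lookup v₀) i y))))) ⟩
          a (suc m) * inv N * (N * bound m)     ≡⟨ solve 4 (λ a k N b → a :* k :* (N :* b) := a :* ((N :* k) :* b)) refl (a (suc m)) (inv N) N (bound m) ⟩
          a (suc m) * (N * inv N * bound m)     ≡⟨ cong (λ z → a (suc m) * (z * bound m)) (*-inv 0<N) ⟩
          a (suc m) * (1ℚ * bound m)            ≡⟨ cong (a (suc m) *_) (*-identityˡ (bound m)) ⟩
          a (suc m) * bound m                   ∎
          where
          0<N : 0ℚ < N
          0<N = 0<freeCount R i Ri (valid v₀∈S)

  -- Survival of a list of rows when one more row is revealed.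

  inside : ∀ {n} → (Fin n → Bool) → List (Fin n) → ℚ
  inside R []       = 1ℚ
  inside R (t ∷ ts) = 𝟙 (R t) * inside R ts

  inside-nonNeg : ∀ {n} (R : Fin n → Bool) ts → 0ℚ ≤ inside R ts
  inside-nonNeg R []       = 0≤1
  inside-nonNeg R (t ∷ ts) = *-nonNeg (𝟙-nonNeg (R t)) (inside-nonNeg R ts)

  multiplicity : ∀ {n} → List (Fin n) → Fin n → ℚ
  multiplicity []       k = 0ℚ
  multiplicity (t ∷ ts) k = δ t k + multiplicity ts k

  multiplicity-∉ : ∀ {n} {t : Fin n} {ts} → All (t ≢_) ts → multiplicity ts t ≡ 0ℚ
  multiplicity-∉ []           = refl
  multiplicity-∉ (t≢u ∷ t∉us) = cong₂ _+_ (δ-≢ (t≢u ∘ sym)) (multiplicity-∉ t∉us)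

  sum-multiplicity : ∀ {n} (ts : List (Fin n)) → sum (multiplicity ts) ≡ ℕ→ℚ (length ts)
  sum-multiplicity {n} []  = sum-replicate-zero n
  sum-multiplicity (t ∷ ts) = trans (∑-distrib-+ (δ t) (multiplicity ts))
    (trans (cong₂ _+_ (sum-δ t) (sum-multiplicity ts)) (sym (ℕ→ℚ-suc (length ts))))

  -- If `ts` lies in `R`, removing k keeps it inside exactly when k is not one of its entries;
  -- otherwise both sides vanish. `Unique` makes the multiplicity 0 or 1. In this additive form the
  -- identity can be summed over k.
  inside-ʳ : ∀ {n} (R : Fin n → Bool) {ts} → Unique ts → ∀ k →
        𝟙 (R k) * inside (R -ʳ k) ts + multiplicity ts k * inside R ts ≡ 𝟙 (R k) * inside R ts
  inside-ʳ R [] k = solve 1 (λ x → x :* con 1ℚ :+ con 0ℚ :* con 1ℚ := x :* con 1ℚ) refl (𝟙 (R k))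
  inside-ʳ R {t ∷ ts} (t∉ts ∷ uniq) k with t Fin.≟ k
  ... | yes refl = begin
    𝟙 (R t) * (𝟙 ((R -ʳ t) t) * inside (R -ʳ t) ts) + (1ℚ + multiplicity ts t) * (𝟙 (R t) * inside R ts)
      ≡⟨ cong₂ (λ y z → 𝟙 (R t) * (𝟙 y * inside (R -ʳ t) ts) + (1ℚ + z) * (𝟙 (R t) * inside R ts)) (-ʳ-self R t) (multiplicity-∉ t∉ts) ⟩
    𝟙 (R t) * (0ℚ * inside (R -ʳ t) ts) + (1ℚ + 0ℚ) * (𝟙 (R t) * inside R ts)
      ≡⟨ solve 3 (λ a b c → a :* (con 0ℚ :* b) :+ (con 1ℚ :+ con 0ℚ) :* (a :* c) := a :* c) refl (𝟙 (R t)) (inside (R -ʳ t) ts) (inside R ts) ⟩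
    𝟙 (R t) * inside R ts
      ≡⟨ cong (_* inside R ts) (idem (R t)) ⟨
    𝟙 (R t) * 𝟙 (R t) * inside R ts
      ≡⟨ *-assoc (𝟙 (R t)) _ _ ⟩
    𝟙 (R t) * (𝟙 (R t) * inside R ts) ∎
    where
    open ≡-Reasoning
    idem : ∀ b → 𝟙 b * 𝟙 b ≡ 𝟙 b
    idem true  = refl
    idem false = refl
  ... | no t≢k = begin
    𝟙 (R k) * (𝟙 ((R -ʳ k) t) * inside (R -ʳ k) ts) + (0ℚ + multiplicity ts k) * (𝟙 (R t) * inside R ts)
      ≡⟨ cong (λ y → 𝟙 (R k) * (𝟙 y * inside (R -ʳ k) ts) + (0ℚ + multiplicity ts k) * (𝟙 (R t) * inside R ts)) (-ʳ-≢ R (t≢k ∘ sym)) ⟩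
    𝟙 (R k) * (𝟙 (R t) * inside (R -ʳ k) ts) + (0ℚ + multiplicity ts k) * (𝟙 (R t) * inside R ts)
      ≡⟨ solve 5 (λ a b c d e → a :* (b :* c) :+ (con 0ℚ :+ d) :* (b :* e) := b :* (a :* c :+ d :* e)) refl (𝟙 (R k)) (𝟙 (R t)) (inside (R -ʳ k) ts) (multiplicity ts k) (inside R ts) ⟩
    𝟙 (R t) * (𝟙 (R k) * inside (R -ʳ k) ts + multiplicity ts k * inside R ts)
      ≡⟨ cong (𝟙 (R t) *_) (inside-ʳ R uniq k) ⟩
    𝟙 (R t) * (𝟙 (R k) * inside R ts)
      ≡⟨ solve 3 (λ a b c → a :* (b :* c) := b :* (a :* c)) refl (𝟙 (R t)) (𝟙 (R k)) (inside R ts) ⟩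
    𝟙 (R k) * (𝟙 (R t) * inside R ts) ∎
    where open ≡-Reasoning

  sum-inside-ʳ : ∀ {n} (R : Fin n → Bool) {ts} m → Unique ts → card R ≡ ℕ→ℚ m →
            sum (λ k → 𝟙 (R k) * inside (R -ʳ k) ts) ≤ ℕ→ℚ (m ∸ length ts) * inside R ts
  sum-inside-ʳ {n} R {ts} m uniq cR = begin
    X                                       ≡⟨ solve 2 (λ x y → x := (x :+ y) :- y) refl X (ℕ→ℚ l * inside R ts) ⟩
    (X + ℕ→ℚ l * inside R ts) - ℕ→ℚ l * inside R ts   ≡⟨ cong (_- ℕ→ℚ l * inside R ts) total ⟩
    -- Truncated subtraction: m ≤ l + (m ∸ l) covers m < l as well, at the price of an inequality.
    ℕ→ℚ m * inside R ts - ℕ→ℚ l * inside R ts         ≤⟨ +-monoˡ-≤ (- (ℕ→ℚ l * inside R ts)) (*ʳ-mono-≤ (inside-nonNeg R ts) (ℕ→ℚ-mono-≤ (ℕₚ.m≤n+m∸n m l))) ⟩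
    ℕ→ℚ (l ℕ.+ (m ∸ l)) * inside R ts - ℕ→ℚ l * inside R ts  ≡⟨ cong (λ z → z * inside R ts - ℕ→ℚ l * inside R ts) (ℕ→ℚ-+ l (m ∸ l)) ⟩
    (ℕ→ℚ l + ℕ→ℚ (m ∸ l)) * inside R ts - ℕ→ℚ l * inside R ts ≡⟨ solve 3 (λ a b t → (a :+ b) :* t :- a :* t := b :* t) refl (ℕ→ℚ l) (ℕ→ℚ (m ∸ l)) (inside R ts) ⟩
    ℕ→ℚ (m ∸ l) * inside R ts                    ∎
    where
    open ≤-Reasoning
    l : ℕ
    l = length ts
    X : ℚ
    X = sum (λ k → 𝟙 (R k) * inside (R -ʳ k) ts)
    total : X + ℕ→ℚ l * inside R ts ≡ ℕ→ℚ m * inside R ts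
    total = begin-equality
      X + ℕ→ℚ l * inside R ts                              ≡⟨ cong (λ z → X + z * inside R ts) (sum-multiplicity ts) ⟨
      X + sum (multiplicity ts) * inside R ts              ≡⟨ cong (X +_) (*-distribʳ-sum (inside R ts) (multiplicity ts)) ⟩
      X + sum (λ k → multiplicity ts k * inside R ts)      ≡⟨ ∑-distrib-+ (λ k → 𝟙 (R k) * inside (R -ʳ k) ts) _ ⟨
      sum (λ k → 𝟙 (R k) * inside (R -ʳ k) ts + multiplicity ts k * inside R ts)  ≡⟨ sum-cong-≗ (inside-ʳ R uniq) ⟩
      sum (λ k → 𝟙 (R k) * inside R ts)                    ≡⟨ *-distribʳ-sum (inside R ts) (𝟙 ∘ R) ⟨
      card R * inside R ts                                 ≡⟨ cong (_* inside R ts) cR ⟩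
      ℕ→ℚ m * inside R ts                                  ∎

  -- Lower bound for the weight of one configuration.

  module WeightBound {n} (ℓ : Fin 3 → Fin n → Fin n → Fin n) (a α : ℕ → ℚ)
    (0≤a : ∀ m → 0ℚ ≤ a m) (0≤α : ∀ m → 0ℚ ≤ α m) (a*α : ∀ m → a (suc m) * α (suc m) ≡ 1ℚ) where

    open Greedy ℓ a 0≤a

    -- The mean over the same orders of R of ∑ Nⱼ / aⱼ.
    cost : ℕ → (Fin n → Bool) → (Fin n → Fin n) → ℚ
    cost zero    R x = 0ℚ
    cost (suc m) R x = sum λ i → 𝟙 (R i) *
      (inv (ℕ→ℚ (suc m)) * (freeCount R x i * α (suc m) + cost m (R -ʳ i) x))

    freeCount-nonNeg : ∀ R x i → 0ℚ ≤ freeCount R x i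
    freeCount-nonNeg R x i = sum-nonNeg λ y → 𝟙-nonNeg (does (free? R x i y))

    -- `us` lists the ratios N/a along the order so far, and p is the product of their inverses. At
    -- a leaf the claim is the tangent inequality for the complete list; before that, both sides
    -- average linearly over the next row. From the empty list and p = 1 it reads `weight` ≥ 1 + m -
    -- `cost`.
    weight-lower : ∀ m R {x us p} → card R ≡ ℕ→ℚ m → Valid x → All (0ℚ ≤_) us → 0ℚ ≤ p → p * prodL us ≡ 1ℚ →
                   ℕ→ℚ (suc (length us ℕ.+ m)) ≤ p * weight m R x + sumL us + cost m R x
    weight-lower zero R {x} {us} {p} cR valid 0≤us 0≤p eq = begin
      ℕ→ℚ (suc (length us ℕ.+ 0))    ≡⟨ cong (ℕ→ℚ ∘ suc) (ℕₚ.+-identityʳ (length us)) ⟩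
      ℕ→ℚ (suc (length us))          ≡⟨ solve 2 (λ c s → c := (c :- s) :+ s) refl (ℕ→ℚ (suc (length us))) (sumL us) ⟩
      ℕ→ℚ (suc (length us)) - sumL us + sumL us  ≤⟨ +-monoˡ-≤ (sumL us) (inverse-prod-tangent 0≤us 0≤p eq) ⟩
      p + sumL us                    ≡⟨ solve 2 (λ p s → p :+ s := p :* con 1ℚ :+ s :+ con 0ℚ) refl p (sumL us) ⟩
      p * 1ℚ + sumL us + 0ℚ          ∎
      where open ≤-Reasoning
    weight-lower (suc m) R {x} {us} {p} cR valid 0≤us 0≤p eq = begin
      L                                                   ≡⟨ sum-𝟙-average R m cR L ⟨
      sum (λ i → 𝟙 (R i) * (r * L))                       ≤⟨ sum-mono-≤ step ⟩
      sum (λ i → p * w i + 𝟙 (R i) * (r * s) + G i)       ≡⟨ ∑-distrib-+ (λ i → p * w i + 𝟙 (R i) * (r * s)) G ⟩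
      sum (λ i → p * w i + 𝟙 (R i) * (r * s)) + sum G     ≡⟨ cong (_+ sum G) (∑-distrib-+ (λ i → p * w i) _) ⟩
      sum (λ i → p * w i) + sum (λ i → 𝟙 (R i) * (r * s)) + sum G  ≡⟨ cong₂ (λ y z → y + z + sum G) (sym (*-distribˡ-sum p w)) (sum-𝟙-average R m cR s) ⟩
      p * sum w + s + sum G                               ∎
      where
      open ≤-Reasoning
      L r s : ℚ
      L = ℕ→ℚ (suc (length us ℕ.+ suc m))
      r = inv (ℕ→ℚ (suc m))
      s = sumL us
      N u h w G : Fin n → ℚ
      N i = freeCount R x i
      u i = N i * α (suc m)
      h i = weight m (R -ʳ i) x
      w i = 𝟙 (R i) * (r * (a (suc m) * inv (N i) * h i))
      G i = 𝟙 (R i) * (r * (u i + cost m (R -ʳ i) x))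
      q : Fin n → ℚ
      q i = p * (a (suc m) * inv (N i))
      ih : ∀ i → R i ≡ true → L ≤ q i * h i + (u i + s) + cost m (R -ʳ i) x
      ih i Ri = subst (λ k → ℕ→ℚ (suc k) ≤ q i * h i + (u i + s) + cost m (R -ʳ i) x) (sym (ℕₚ.+-suc (length us) m))
        (weight-lower m (R -ʳ i) {x} {u i ∷ us} {q i} (card-ʳ R m Ri cR) valid
          (*-nonNeg (freeCount-nonNeg R x i) (0≤α (suc m)) ∷ 0≤us)
          (*-nonNeg 0≤p (*-nonNeg (0≤a (suc m)) (inv-nonNeg (freeCount-nonNeg R x i))))
          (begin-equality
            p * (a (suc m) * inv (N i)) * (N i * α (suc m) * prodL us)
              ≡⟨ solve 6 (λ p a k N α P → p :* (a :* k) :* (N :* α :* P) := (p :* P) :* (a :* α) :* (N :* k)) refl p (a (suc m)) (inv (N i)) (N i) (α (suc m)) (prodL us) ⟩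
            p * prodL us * (a (suc m) * α (suc m)) * (N i * inv (N i))
              ≡⟨ cong₂ _*_ (cong₂ _*_ eq (a*α m)) (*-inv (0<freeCount R i Ri valid)) ⟩
            1ℚ ∎))
      step : ∀ i → 𝟙 (R i) * (r * L) ≤ p * w i + 𝟙 (R i) * (r * s) + G i
      step i = begin
        𝟙 (R i) * (r * L)   ≤⟨ 𝟙-mono-*-≤ (R i) (λ Ri → *ˡ-mono-≤ (inv-nonNeg (ℕ→ℚ-nonNeg (suc m))) (ih i Ri)) ⟩
        𝟙 (R i) * (r * (q i * h i + (u i + s) + cost m (R -ʳ i) x))
          ≡⟨ solve 8 (λ b r p k h u s c → b :* (r :* (p :* k :* h :+ (u :+ s) :+ c)) := p :* (b :* (r :* (k :* h))) :+ b :* (r :* s) :+ b :* (r :* (u :+ c))) refl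
               (𝟙 (R i)) r p (a (suc m) * inv (N i)) (h i) (u i) s (cost m (R -ʳ i) x) ⟩
        p * w i + 𝟙 (R i) * (r * s) + G i  ∎

  inside-full : ∀ {n} (R : Fin n → Bool) {ts} → All (λ t → R t ≡ true) ts → inside R ts ≡ 1ℚ
  inside-full R []         = refl
  inside-full R (Rt ∷ Rts) = cong₂ _*_ (cong 𝟙 Rt) (inside-full R Rts)

  -- The mean number of free columns.

  module CostBound {n} (ℓ : Fin 3 → Fin n → Fin n → Fin n) (a α : ℕ → ℚ)
    (0≤a : ∀ m → 0ℚ ≤ a m) (0≤α : ∀ m → 0ℚ ≤ α m) (a*α : ∀ m → a (suc m) * α (suc m) ≡ 1ℚ)
    (x : Fin n → Fin n) (attacker : Fin 3 → Fin n → Fin n → Fin n)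
    (ℓ-attacker : ∀ c i y → ℓ c (attacker c i y) (x (attacker c i y)) ≡ ℓ c i y)
    (attackers-unique : ∀ {i y} → x i ≢ y → Unique (i ∷ attacker 0F i y ∷ attacker 1F i y ∷ attacker 2F i y ∷ []))
    where

    open Greedy ℓ a 0≤a
    open WeightBound ℓ a α 0≤a 0≤α a*α

    attackers : Fin n → Fin n → List (Fin n)
    attackers i y = attacker 0F i y ∷ attacker 1F i y ∷ attacker 2F i y ∷ []

    off : Fin n → Fin n → Bool
    off i y = not (does (x i Fin.≟ y))

    δ+off : ∀ i y → δ (x i) y + 𝟙 (off i y) ≡ 1ℚ
    δ+off i y with x i Fin.≟ y
    ... | yes _ = refl
    ... | no _  = refl

    off⇒≢ : ∀ {i y} → off i y ≡ true → x i ≢ y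
    off⇒≢ {i} {y} eq with x i Fin.≟ y
    ... | no xi≢y = xi≢y

    unattackedCount : (Fin n → Bool) → Fin n → ℚ
    unattackedCount R i = sum λ y → 𝟙 (off i y) * inside R (attackers i y)

    unattacked : (Fin n → Bool) → ℚ
    unattacked R = sum λ i → 𝟙 (R i) * unattackedCount R i

    -- Absorbing the indicator of row i makes each off cell a list of four rows that must lie in
    -- `R`, the shape that `sum-inside-ʳ` handles.
    unattacked-as-inside : ∀ R → unattacked R ≡ sum λ i → sum λ y → 𝟙 (off i y) * inside R (i ∷ attackers i y)
    unattacked-as-inside R = sum-cong-≗ λ i → trans (*-distribˡ-sum (𝟙 (R i)) (λ y → 𝟙 (off i y) * inside R (attackers i y)))
      (sum-cong-≗ λ y → solve 3 (λ r o t → r :* (o :* t) := o :* (r :* t)) refl (𝟙 (R i)) (𝟙 (off i y)) (inside R (attackers i y)))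

    free⇒attackers∈ : ∀ R {i y} → Free R x i y → ∀ c → R (attacker c i y) ≡ true
    free⇒attackers∈ R {i} {y} free c with R (attacker c i y) in eq
    ... | true  = refl
    ... | false = contradiction (ℓ-attacker c i y) (free (attacker c i y) eq c)

    -- The 1 is the column of the queen itself. Any other free column needs its three attackers
    -- unrevealed, since a revealed attacker shares a line with it.
    freeCount-≤ : ∀ R i → freeCount R x i ≤ 1ℚ + unattackedCount R i
    freeCount-≤ R i = begin
      freeCount R x i                                                     ≤⟨ sum-mono-≤ step ⟩
      sum (λ y → δ (x i) y + 𝟙 (off i y) * inside R (attackers i y))           ≡⟨ ∑-distrib-+ (δ (x i)) _ ⟩
      sum (δ (x i)) + unattackedCount R i                                 ≡⟨ cong (_+ unattackedCount R i) (sum-δ (x i)) ⟩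
      1ℚ + unattackedCount R i                                            ∎
      where
      open ≤-Reasoning
      step : ∀ y → 𝟙 (does (free? R x i y)) ≤ δ (x i) y + 𝟙 (off i y) * inside R (attackers i y)
      step y with free? R x i y
      ... | no _     = +-nonNeg (𝟙-nonNeg (does (x i Fin.≟ y))) (*-nonNeg (𝟙-nonNeg (off i y)) (inside-nonNeg R (attackers i y)))
      ... | yes free = ≤-reflexive (begin-equality
        1ℚ                                               ≡⟨ δ+off i y ⟨
        δ (x i) y + 𝟙 (off i y)                          ≡⟨ cong (δ (x i) y +_) (*-identityʳ (𝟙 (off i y))) ⟨
        δ (x i) y + 𝟙 (off i y) * 1ℚ                     ≡⟨ cong (λ z → δ (x i) y + 𝟙 (off i y) * z)
                                                              (inside-full R (free⇒attackers∈ R free 0F ∷ free⇒attackers∈ R free 1F ∷ free⇒attackers∈ R free 2F ∷ [])) ⟨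
        δ (x i) y + 𝟙 (off i y) * inside R (attackers i y)    ∎)

    -- Each surviving off cell involves four distinct rows, so only m - 4 of the m choices for the
    -- next row preserve it. Exchange the sums and apply `sum-inside-ʳ` cell by cell.
    unattacked-ʳ : ∀ R m → card R ≡ ℕ→ℚ m → sum (λ k → 𝟙 (R k) * unattacked (R -ʳ k)) ≤ ℕ→ℚ (m ∸ 4) * unattacked R
    unattacked-ʳ R m cR = begin
      sum (λ k → 𝟙 (R k) * unattacked (R -ʳ k))                                        ≡⟨ sum-cong-≗ expand ⟩
      sum (λ k → sum λ i → sum λ y → 𝟙 (off i y) * (𝟙 (R k) * inside (R -ʳ k) (quad i y)))  ≡⟨ ∑-comm (λ k i → sum λ y → 𝟙 (off i y) * (𝟙 (R k) * inside (R -ʳ k) (quad i y))) ⟩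
      sum (λ i → sum λ k → sum λ y → 𝟙 (off i y) * (𝟙 (R k) * inside (R -ʳ k) (quad i y)))  ≡⟨ sum-cong-≗ (λ i → ∑-comm (λ k y → 𝟙 (off i y) * (𝟙 (R k) * inside (R -ʳ k) (quad i y)))) ⟩
      sum (λ i → sum λ y → sum λ k → 𝟙 (off i y) * (𝟙 (R k) * inside (R -ʳ k) (quad i y)))  ≤⟨ sum-mono-≤ (λ i → sum-mono-≤ (λ y → step i y)) ⟩
      sum (λ i → sum λ y → c * (𝟙 (off i y) * inside R (quad i y)))                         ≡⟨ sum-cong-≗ (λ i → sym (*-distribˡ-sum c (λ y → 𝟙 (off i y) * inside R (quad i y)))) ⟩
      sum (λ i → c * sum λ y → 𝟙 (off i y) * inside R (quad i y))                           ≡⟨ *-distribˡ-sum c (λ i → sum λ y → 𝟙 (off i y) * inside R (quad i y)) ⟨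
      c * sum (λ i → sum λ y → 𝟙 (off i y) * inside R (quad i y))                           ≡⟨ cong (c *_) (unattacked-as-inside R) ⟨
      c * unattacked R                                                                 ∎
      where
      open ≤-Reasoning
      c : ℚ
      c = ℕ→ℚ (m ∸ 4)
      quad : Fin n → Fin n → List (Fin n)
      quad i y = i ∷ attackers i y
      expand : ∀ k → 𝟙 (R k) * unattacked (R -ʳ k) ≡ sum λ i → sum λ y → 𝟙 (off i y) * (𝟙 (R k) * inside (R -ʳ k) (quad i y))
      expand k = begin-equality
        𝟙 (R k) * unattacked (R -ʳ k)
          ≡⟨ cong (𝟙 (R k) *_) (unattacked-as-inside (R -ʳ k)) ⟩
        𝟙 (R k) * sum (λ i → sum λ y → 𝟙 (off i y) * inside (R -ʳ k) (quad i y))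
          ≡⟨ *-distribˡ-sum (𝟙 (R k)) (λ i → sum λ y → 𝟙 (off i y) * inside (R -ʳ k) (quad i y)) ⟩
        sum (λ i → 𝟙 (R k) * sum λ y → 𝟙 (off i y) * inside (R -ʳ k) (quad i y))
          ≡⟨ sum-cong-≗ (λ i → *-distribˡ-sum (𝟙 (R k)) (λ y → 𝟙 (off i y) * inside (R -ʳ k) (quad i y))) ⟩
        sum (λ i → sum λ y → 𝟙 (R k) * (𝟙 (off i y) * inside (R -ʳ k) (quad i y)))
          ≡⟨ sum-cong-≗ (λ i → sum-cong-≗ λ y → solve 3 (λ r o t → r :* (o :* t) := o :* (r :* t)) refl (𝟙 (R k)) (𝟙 (off i y)) (inside (R -ʳ k) (quad i y))) ⟩
        sum (λ i → sum λ y → 𝟙 (off i y) * (𝟙 (R k) * inside (R -ʳ k) (quad i y))) ∎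
      step : ∀ i y → sum (λ k → 𝟙 (off i y) * (𝟙 (R k) * inside (R -ʳ k) (quad i y))) ≤ c * (𝟙 (off i y) * inside R (quad i y))
      step i y = begin
        sum (λ k → 𝟙 (off i y) * (𝟙 (R k) * inside (R -ʳ k) (quad i y)))  ≡⟨ *-distribˡ-sum (𝟙 (off i y)) (λ k → 𝟙 (R k) * inside (R -ʳ k) (quad i y)) ⟨
        𝟙 (off i y) * sum (λ k → 𝟙 (R k) * inside (R -ʳ k) (quad i y))    ≤⟨ 𝟙-mono-*-≤ (off i y) (λ eq → sum-inside-ʳ R m (attackers-unique (off⇒≢ eq)) cR) ⟩
        𝟙 (off i y) * (c * inside R (quad i y))                           ≡⟨ solve 3 (λ o c t → o :* (c :* t) := c :* (o :* t)) refl (𝟙 (off i y)) c (inside R (quad i y)) ⟩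
        c * (𝟙 (off i y) * inside R (quad i y))                           ∎

    -- `baseCost` collects the queens' own columns. `pairCost m` is the mean contribution of one off
    -- cell whose four rows are among the m unrevealed ones: its own row comes next with probability
    -- 1/m and pays `α m`, while a row outside the four leaves the cell alive. Hence `m ∸ 3` in the
    -- clause for `suc m`, which is (m + 1) - 4.
    baseCost pairCost : ℕ → ℚ
    baseCost zero    = 0ℚ
    baseCost (suc m) = α (suc m) + baseCost m
    pairCost zero    = 0ℚ
    pairCost (suc m) = inv (ℕ→ℚ (suc m)) * (α (suc m) + ℕ→ℚ (m ∸ 3) * pairCost m)

    pairCost-nonNeg : ∀ m → 0ℚ ≤ pairCost m
    pairCost-nonNeg zero    = ≤-refl
    pairCost-nonNeg (suc m) = *-nonNeg (inv-nonNeg (ℕ→ℚ-nonNeg (suc m)))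
      (+-nonNeg (0≤α (suc m)) (*-nonNeg (ℕ→ℚ-nonNeg (m ∸ 3)) (pairCost-nonNeg m)))

    -- The bound is linear in `unattacked R`, and by `unattacked-ʳ` the average over the next row
    -- stays linear in it, so no other information about `R` enters the induction.
    cost-≤ : ∀ m R → card R ≡ ℕ→ℚ m → cost m R x ≤ baseCost m + unattacked R * pairCost m
    cost-≤ zero    R cR = ≤-reflexive (solve 1 (λ q → con 0ℚ := con 0ℚ :+ q :* con 0ℚ) refl (unattacked R))
    cost-≤ (suc m) R cR = begin
      cost (suc m) R x
        ≤⟨ sum-mono-≤ step ⟩
      sum (λ i → 𝟙 (R i) * (r * s) + (r * αₘ * q i + r * g * Q′ i))
        ≡⟨ ∑-distrib-+ (λ i → 𝟙 (R i) * (r * s)) _ ⟩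
      sum (λ i → 𝟙 (R i) * (r * s)) + sum (λ i → r * αₘ * q i + r * g * Q′ i)
        ≡⟨ cong₂ _+_ (sum-𝟙-average R m cR s) (∑-distrib-+ (λ i → r * αₘ * q i) _) ⟩
      s + (sum (λ i → r * αₘ * q i) + sum (λ i → r * g * Q′ i))
        ≡⟨ cong₂ (λ y z → s + (y + z)) (sym (*-distribˡ-sum (r * αₘ) q)) (sym (*-distribˡ-sum (r * g) Q′)) ⟩
      s + (r * αₘ * unattacked R + r * g * sum Q′)
        ≤⟨ +-monoʳ-≤ s (+-monoʳ-≤ (r * αₘ * unattacked R) (*ˡ-mono-≤ (*-nonNeg 0≤r (pairCost-nonNeg m)) (unattacked-ʳ R (suc m) cR))) ⟩
      s + (r * αₘ * unattacked R + r * g * (ℕ→ℚ (m ∸ 3) * unattacked R))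
        ≡⟨ solve 6 (λ s r α q g c → s :+ (r :* α :* q :+ r :* g :* (c :* q)) := s :+ q :* (r :* (α :+ c :* g))) refl s r αₘ (unattacked R) g (ℕ→ℚ (m ∸ 3)) ⟩
      s + unattacked R * pairCost (suc m) ∎
      where
      open ≤-Reasoning
      r αₘ g s : ℚ
      r  = inv (ℕ→ℚ (suc m))
      αₘ = α (suc m)
      g  = pairCost m
      s  = αₘ + baseCost m
      q Q′ : Fin n → ℚ
      q i  = 𝟙 (R i) * unattackedCount R i
      Q′ i = 𝟙 (R i) * unattacked (R -ʳ i)
      0≤r : 0ℚ ≤ r
      0≤r = inv-nonNeg (ℕ→ℚ-nonNeg (suc m))
      step : ∀ i → 𝟙 (R i) * (r * (freeCount R x i * αₘ + cost m (R -ʳ i) x)) ≤ 𝟙 (R i) * (r * s) + (r * αₘ * q i + r * g * Q′ i)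
      step i = begin
        𝟙 (R i) * (r * (freeCount R x i * αₘ + cost m (R -ʳ i) x))
          ≤⟨ 𝟙-mono-*-≤ (R i) (λ Ri → *ˡ-mono-≤ 0≤r (+-mono-≤ (*ʳ-mono-≤ (0≤α (suc m)) (freeCount-≤ R i)) (cost-≤ m (R -ʳ i) (card-ʳ R m Ri cR)))) ⟩
        𝟙 (R i) * (r * ((1ℚ + unattackedCount R i) * αₘ + (baseCost m + unattacked (R -ʳ i) * g)))
          ≡⟨ solve 7 (λ b r u α h q g → b :* (r :* ((con 1ℚ :+ u) :* α :+ (h :+ q :* g))) := b :* (r :* (α :+ h)) :+ (r :* α :* (b :* u) :+ r :* g :* (b :* q))) refl
               (𝟙 (R i)) r (unattackedCount R i) αₘ (baseCost m) (unattacked (R -ʳ i)) g ⟩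
        𝟙 (R i) * (r * s) + (r * αₘ * q i + r * g * Q′ i) ∎

    full : Fin n → Bool
    full _ = true

    unattacked-full : unattacked full ≤ ℕ→ℚ n * (ℕ→ℚ n - 1ℚ)
    unattacked-full = ≤-reflexive (begin
      sum (λ i → 1ℚ * unattackedCount full i)  ≡⟨ sum-cong-≗ (λ i → trans (*-identityˡ (unattackedCount full i)) (row i)) ⟩
      sum {n} (λ i → ℕ→ℚ n - 1ℚ)                   ≡⟨ sum-const n (ℕ→ℚ n - 1ℚ) ⟩
      ℕ→ℚ n * (ℕ→ℚ n - 1ℚ)                     ∎)
      where
      open ≡-Reasoning
      sum-const : ∀ k c → sum {k} (λ _ → c) ≡ ℕ→ℚ k * c
      sum-const zero    c = sym (*-zeroˡ c)
      sum-const (suc k) c = begin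
        c + sum {k} (λ _ → c)  ≡⟨ cong (c +_) (sum-const k c) ⟩
        c + ℕ→ℚ k * c          ≡⟨ solve 2 (λ c k → c :+ k :* c := (con 1ℚ :+ k) :* c) refl c (ℕ→ℚ k) ⟩
        (1ℚ + ℕ→ℚ k) * c       ≡⟨ cong (_* c) (ℕ→ℚ-suc k) ⟨
        ℕ→ℚ (suc k) * c        ∎
      row : ∀ i → unattackedCount full i ≡ ℕ→ℚ n - 1ℚ
      row i = begin
        unattackedCount full i              ≡⟨ sum-cong-≗ (λ y → *-identityʳ (𝟙 (off i y))) ⟩
        o                                   ≡⟨ solve 2 (λ d o → o := (d :+ o) :- d) refl (sum (δ (x i))) o ⟩
        (sum (δ (x i)) + o) - sum (δ (x i)) ≡⟨ cong₂ _-_ (sym (∑-distrib-+ (δ (x i)) (λ y → 𝟙 (off i y)))) (sum-δ (x i)) ⟩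
        sum (λ y → δ (x i) y + 𝟙 (off i y)) - 1ℚ ≡⟨ cong (_- 1ℚ) (trans (sum-cong-≗ (δ+off i)) (trans (sum-const n 1ℚ) (*-identityʳ (ℕ→ℚ n)))) ⟩
        ℕ→ℚ n - 1ℚ                          ∎
        where
        o : ℚ
        o = sum (λ y → 𝟙 (off i y))

  ℕ→ℚ-cancel-≤ : ∀ {a b} → ℕ→ℚ a ≤ ℕ→ℚ b → a ℕ.≤ b
  ℕ→ℚ-cancel-≤ {a} {b} ιa≤ιb = ℕₚ.≮⇒≥ λ b<a → <-irrefl refl (begin-strict
    ℕ→ℚ b            ≡⟨ +-identityˡ (ℕ→ℚ b) ⟨
    0ℚ + ℕ→ℚ b       <⟨ +-monoˡ-< (ℕ→ℚ b) (positive⁻¹ 1ℚ) ⟩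
    1ℚ + ℕ→ℚ b       ≡⟨ ℕ→ℚ-suc b ⟨
    ℕ→ℚ (suc b)      ≤⟨ ℕ→ℚ-mono-≤ b<a ⟩
    ℕ→ℚ a            ≤⟨ ιa≤ιb ⟩
    ℕ→ℚ b            ∎)
    where open ≤-Reasoning

  sumOver-≥-length : ∀ {A : Set} {f : A → ℚ} xs → (∀ {x} → x ∈ xs → 1ℚ ≤ f x) → ℕ→ℚ (length xs) ≤ sumOver xs f
  sumOver-≥-length []       1≤f = ≤-refl
  sumOver-≥-length {f = f} (x ∷ xs) 1≤f = begin
    ℕ→ℚ (suc (length xs))   ≡⟨ ℕ→ℚ-suc (length xs) ⟩
    1ℚ + ℕ→ℚ (length xs)    ≤⟨ +-mono-≤ (1≤f (here refl)) (sumOver-≥-length xs (1≤f ∘ there)) ⟩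
    f x + sumOver xs f      ∎
    where open ≤-Reasoning

  card-full : ∀ n → card {n} (λ _ → true) ≡ ℕ→ℚ n
  card-full zero    = refl
  card-full (suc n) = trans (cong (1ℚ +_) (card-full n)) (sym (ℕ→ℚ-suc n))

  -- The counting inequality for the chosen means `a`.

  module Counting {n} (4≤n : 4 ℕ.≤ n) (ℓ : Fin 3 → Fin n → Fin n → Fin n) where

    D : ℕ
    D = (n ∸ 2) ℕ.* (n ∸ 3)

    0<D : 0ℚ < ℕ→ℚ D
    0<D = <-≤-trans (positive⁻¹ 1ℚ) (ℕ→ℚ-mono-≤ (ℕₚ.*-mono-≤ {1} {_} {1} (ℕₚ.≤-trans (ℕ.s≤s ℕ.z≤n) (ℕₚ.∸-monoˡ-≤ 2 4≤n)) (ℕₚ.∸-monoˡ-≤ 3 4≤n)))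

    D⁻¹ : ℚ
    D⁻¹ = inv (ℕ→ℚ D)

    -- a (suc j) is the mean number of free columns when j further rows are unrevealed:
    -- 1 + (n − 1) C(j, 3) / C(n − 1, 3).
    a α : ℕ → ℚ
    a m = 1ℚ + ℕ→ℚ (falling₃ (m ∸ 1)) * D⁻¹
    α m = inv (a m)

    1≤a : ∀ m → 1ℚ ≤ a m
    1≤a m = ≤-trans (≤-reflexive (sym (+-identityʳ 1ℚ)))
      (+-monoʳ-≤ 1ℚ (*-nonNeg (ℕ→ℚ-nonNeg (falling₃ (m ∸ 1))) (inv-nonNeg (ℕ→ℚ-nonNeg D))))

    0≤a : ∀ m → 0ℚ ≤ a m
    0≤a m = ≤-trans 0≤1 (1≤a m)

    0≤α : ∀ m → 0ℚ ≤ α m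
    0≤α m = inv-nonNeg (0≤a m)

    a*α : ∀ m → a (suc m) * α (suc m) ≡ 1ℚ
    a*α m = *-inv (<-≤-trans (positive⁻¹ 1ℚ) (1≤a (suc m)))

    open Greedy ℓ a 0≤a
    open WeightBound ℓ a α 0≤a 0≤α a*α

    bound*D^ : ∀ m → bound m * ℕ→ℚ (D ℕ.^ m) ≡ ℕ→ℚ (cubicProduct D m)
    bound*D^ zero    = refl
    bound*D^ (suc m) = begin
      (1ℚ + c * D⁻¹) * bound m * ℕ→ℚ (D ℕ.* D ℕ.^ m)        ≡⟨ cong ((1ℚ + c * D⁻¹) * bound m *_) (ℕ→ℚ-* D (D ℕ.^ m)) ⟩
      (1ℚ + c * D⁻¹) * bound m * (d * p)                    ≡⟨ solve 5 (λ c D⁻¹ b d p → (con 1ℚ :+ c :* D⁻¹) :* b :* (d :* p) := (d :+ c :* (d :* D⁻¹)) :* (b :* p)) refl c D⁻¹ (bound m) d p ⟩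
      (d + c * (d * D⁻¹)) * (bound m * p)                   ≡⟨ cong₂ (λ y z → (d + c * y) * z) (*-inv 0<D) (bound*D^ m) ⟩
      (d + c * 1ℚ) * ℕ→ℚ (cubicProduct D m)                 ≡⟨ cong (λ z → (d + z) * ℕ→ℚ (cubicProduct D m)) (*-identityʳ c) ⟩
      (d + c) * ℕ→ℚ (cubicProduct D m)                      ≡⟨ cong (_* ℕ→ℚ (cubicProduct D m)) (ℕ→ℚ-+ D (falling₃ m)) ⟨
      ℕ→ℚ (D ℕ.+ falling₃ m) * ℕ→ℚ (cubicProduct D m)       ≡⟨ ℕ→ℚ-* (D ℕ.+ falling₃ m) (cubicProduct D m) ⟨
      ℕ→ℚ (cubicProduct D (suc m))                          ∎
      where
      open ≡-Reasoning
      c d p : ℚ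
      c = ℕ→ℚ (falling₃ m)
      d = ℕ→ℚ D
      p = ℕ→ℚ (D ℕ.^ m)

    HasAttackers : (Fin n → Fin n) → Set
    HasAttackers x = Σ[ attacker ∈ (Fin 3 → Fin n → Fin n → Fin n) ]
      (∀ c i y → ℓ c (attacker c i y) (x (attacker c i y)) ≡ ℓ c i y) ×
      (∀ {i y} → x i ≢ y → Unique (i ∷ attacker 0F i y ∷ attacker 1F i y ∷ attacker 2F i y ∷ []))

    -- The choice of `a` is made for this: once the recursion for `pairCost` is solved, the terms
    -- regroup by j into αⱼ(1 + `falling₃` (j - 1) / D) = αⱼaⱼ = 1, one for each of the n rows.
    cost-full-≤ : ∀ {x} → HasAttackers x → cost n (λ _ → true) x ≤ ℕ→ℚ n
    cost-full-≤ {x} (attacker , ℓ-attacker , attackers-unique) = begin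
      cost n full x                                                ≤⟨ cost-≤ n full (card-full n) ⟩
      baseCost n + unattacked full * pairCost n                    ≤⟨ +-monoʳ-≤ (baseCost n) (*ʳ-mono-≤ (pairCost-nonNeg n) unattacked-full) ⟩
      baseCost n + ℕ→ℚ n * (ℕ→ℚ n - 1ℚ) * pairCost n               ≡⟨ cong (baseCost n +_) pairs ⟩
      baseCost n + D⁻¹ * K n                                       ≡⟨ baseCost+K n ⟩
      ℕ→ℚ n                                                        ∎
      where
      open ≤-Reasoning
      open CostBound ℓ a α 0≤a 0≤α a*α x attacker ℓ-attacker attackers-unique
      K : ℕ → ℚ
      K zero    = 0ℚ
      K (suc m) = ℕ→ℚ (falling₃ m) * α (suc m) + K m

      baseCost+K : ∀ m → baseCost m + D⁻¹ * K m ≡ ℕ→ℚ m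
      baseCost+K zero    = solve 1 (λ d → con 0ℚ :+ d :* con 0ℚ := con 0ℚ) refl D⁻¹
      baseCost+K (suc m) = begin-equality
        (αₘ + baseCost m) + D⁻¹ * (c * αₘ + K m)      ≡⟨ solve 5 (λ α b d c k → (α :+ b) :+ d :* (c :* α :+ k) := (con 1ℚ :+ c :* d) :* α :+ (b :+ d :* k)) refl αₘ (baseCost m) D⁻¹ c (K m) ⟩
        a (suc m) * αₘ + (baseCost m + D⁻¹ * K m)     ≡⟨ cong₂ _+_ (a*α m) (baseCost+K m) ⟩
        1ℚ + ℕ→ℚ m                                    ≡⟨ ℕ→ℚ-suc m ⟨
        ℕ→ℚ (suc m)                                   ∎
        where
        αₘ c : ℚ
        αₘ = α (suc m)
        c  = ℕ→ℚ (falling₃ m)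

      -- The fourth falling factorial is the integrating factor of the recursion: its value at m +
      -- 1, divided by m + 1, is `falling₃ m`, and `falling₃ m` times m - 3 is its value at m. The
      -- recursion thus telescopes to the sum `K`.
      falling₄*pairCost : ∀ m → ℕ→ℚ (falling₃ m ℕ.* (m ∸ 3)) * pairCost m ≡ K m
      falling₄*pairCost zero    = refl
      falling₄*pairCost (suc m) = begin-equality
        ℕ→ℚ (falling₃ (suc m) ℕ.* (m ∸ 2)) * (r * (αₘ + e * g))  ≡⟨ cong (λ z → ℕ→ℚ z * (r * (αₘ + e * g))) shuffle ⟩
        ℕ→ℚ (suc m ℕ.* falling₃ m) * (r * (αₘ + e * g))          ≡⟨ cong (_* (r * (αₘ + e * g))) (ℕ→ℚ-* (suc m) (falling₃ m)) ⟩
        ℕ→ℚ (suc m) * c * (r * (αₘ + e * g))                     ≡⟨ solve 6 (λ s c r α e g → s :* c :* (r :* (α :+ e :* g)) := (s :* r) :* (c :* α :+ c :* e :* g)) refl (ℕ→ℚ (suc m)) c r αₘ e g ⟩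
        ℕ→ℚ (suc m) * r * (c * αₘ + c * e * g)                   ≡⟨ cong₂ (λ y z → y * (c * αₘ + z * g)) (*-inv (0<ℕ→ℚ-suc m)) (sym (ℕ→ℚ-* (falling₃ m) (m ∸ 3))) ⟩
        1ℚ * (c * αₘ + ℕ→ℚ (falling₃ m ℕ.* (m ∸ 3)) * g)         ≡⟨ *-identityˡ _ ⟩
        c * αₘ + ℕ→ℚ (falling₃ m ℕ.* (m ∸ 3)) * g                ≡⟨ cong (c * αₘ +_) (falling₄*pairCost m) ⟩
        c * αₘ + K m                                             ∎
        where
        αₘ c r e g : ℚ
        αₘ = α (suc m)
        c  = ℕ→ℚ (falling₃ m)
        r  = inv (ℕ→ℚ (suc m))
        e  = ℕ→ℚ (m ∸ 3)
        g  = pairCost m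
        shuffle : falling₃ (suc m) ℕ.* (m ∸ 2) ≡ suc m ℕ.* falling₃ m
        shuffle = S.solve 4 (λ s m p q → s S.:* m S.:* p S.:* q S.:= s S.:* (m S.:* p S.:* q)) refl (suc m) m (m ∸ 1) (m ∸ 2)
          where module S = ℕSolver.+-*-Solver

      pairs : ℕ→ℚ n * (ℕ→ℚ n - 1ℚ) * pairCost n ≡ D⁻¹ * K n
      pairs = begin-equality
        ℕ→ℚ n * (ℕ→ℚ n - 1ℚ) * g              ≡⟨ cong (λ z → ℕ→ℚ n * z * g) n-1 ⟩
        ℕ→ℚ n * ℕ→ℚ (n ∸ 1) * g               ≡⟨ cong (_* g) (ℕ→ℚ-* n (n ∸ 1)) ⟨
        b * g                                 ≡⟨ *-identityˡ (b * g) ⟨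
        1ℚ * (b * g)                          ≡⟨ cong (_* (b * g)) (*-inv 0<D) ⟨
        ℕ→ℚ D * D⁻¹ * (b * g)                 ≡⟨ solve 4 (λ d i b g → d :* i :* (b :* g) := i :* (b :* d :* g)) refl (ℕ→ℚ D) D⁻¹ b g ⟩
        D⁻¹ * (b * ℕ→ℚ D * g)                 ≡⟨ cong (λ z → D⁻¹ * (z * g)) (ℕ→ℚ-* (n ℕ.* (n ∸ 1)) D) ⟨
        D⁻¹ * (ℕ→ℚ (n ℕ.* (n ∸ 1) ℕ.* D) * g) ≡⟨ cong (λ z → D⁻¹ * (ℕ→ℚ z * g)) (sym (ℕₚ.*-assoc (n ℕ.* (n ∸ 1)) (n ∸ 2) (n ∸ 3))) ⟩
        D⁻¹ * (ℕ→ℚ (falling₃ n ℕ.* (n ∸ 3)) * g) ≡⟨ cong (D⁻¹ *_) (falling₄*pairCost n) ⟩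
        D⁻¹ * K n                             ∎
        where
        b g : ℚ
        b = ℕ→ℚ (n ℕ.* (n ∸ 1))
        g = pairCost n
        n-1 : ℕ→ℚ n - 1ℚ ≡ ℕ→ℚ (n ∸ 1)
        n-1 = begin-equality
          ℕ→ℚ n - 1ℚ                ≡⟨ cong (λ z → ℕ→ℚ z - 1ℚ) (ℕₚ.m+[n∸m]≡n (ℕₚ.≤-trans (ℕ.s≤s ℕ.z≤n) 4≤n)) ⟨
          ℕ→ℚ (suc (n ∸ 1)) - 1ℚ    ≡⟨ cong (_- 1ℚ) (ℕ→ℚ-suc (n ∸ 1)) ⟩
          (1ℚ + ℕ→ℚ (n ∸ 1)) - 1ℚ   ≡⟨ solve 1 (λ z → (con 1ℚ :+ z) :- con 1ℚ := z) refl (ℕ→ℚ (n ∸ 1)) ⟩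
          ℕ→ℚ (n ∸ 1)               ∎

    1≤weight : ∀ {x} → Valid x → HasAttackers x → 1ℚ ≤ weight n (λ _ → true) x
    1≤weight {x} valid att = begin
      1ℚ                                  ≡⟨ solve 1 (λ z → con 1ℚ := (con 1ℚ :+ z) :- z) refl (ℕ→ℚ n) ⟩
      (1ℚ + ℕ→ℚ n) - ℕ→ℚ n                ≡⟨ cong (_- ℕ→ℚ n) (ℕ→ℚ-suc n) ⟨
      ℕ→ℚ (suc n) - ℕ→ℚ n                 ≤⟨ +-monoˡ-≤ (- ℕ→ℚ n) (weight-lower n _ (card-full n) valid [] 0≤1 refl) ⟩
      (1ℚ * w + 0ℚ + cost n (λ _ → true) x) - ℕ→ℚ n  ≤⟨ +-monoˡ-≤ (- ℕ→ℚ n) (+-monoʳ-≤ (1ℚ * w + 0ℚ) (cost-full-≤ att)) ⟩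
      (1ℚ * w + 0ℚ + ℕ→ℚ n) - ℕ→ℚ n       ≡⟨ solve 2 (λ w z → (con 1ℚ :* w :+ con 0ℚ :+ z) :- z := w) refl w (ℕ→ℚ n) ⟩
      w                                   ∎
      where
      open ≤-Reasoning
      w : ℚ
      w = weight n (λ _ → true) x

    length*D^≤cubicProduct : (S : List (Vec (Fin n) n)) → Unique S →
      (∀ {v} → v ∈ S → Valid (lookup v)) → (∀ {v} → v ∈ S → HasAttackers (lookup v)) →
      length S ℕ.* D ℕ.^ n ℕ.≤ cubicProduct D n
    length*D^≤cubicProduct S uniq valid att = ℕ→ℚ-cancel-≤ (begin
      ℕ→ℚ (length S ℕ.* D ℕ.^ n)          ≡⟨ ℕ→ℚ-* (length S) (D ℕ.^ n) ⟩
      ℕ→ℚ (length S) * ℕ→ℚ (D ℕ.^ n)      ≤⟨ *ʳ-mono-≤ (ℕ→ℚ-nonNeg (D ℕ.^ n)) (begin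
        ℕ→ℚ (length S)                                ≤⟨ sumOver-≥-length S (λ v∈S → 1≤weight (valid v∈S) (att v∈S)) ⟩
        -- Initially every row is unrevealed, so agreement on revealed rows is vacuous.
        sumOver S (weight n (λ _ → true) ∘ lookup)    ≤⟨ sum-weight-≤ n _ S (card-full n) uniq valid (λ _ _ _ ()) ⟩
        bound n                                       ∎) ⟩
      bound n * ℕ→ℚ (D ℕ.^ n)             ≡⟨ bound*D^ n ⟩
      ℕ→ℚ (cubicProduct D n)              ∎)
      where open ≤-Reasoning

-- Lines on the torus and arithmetic modulo n.

module TorusLines where

  open import Data.Nat
  open import Data.Nat.Properties
  open import Data.Nat.DivMod
  open import Data.Nat.Divisibility
  open import Data.Nat.Solver using (module +-*-Solver)
  open import Algebra.Properties.Semiring.Sum +-*-semiring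
  open NaturalBounds using (cubicProduct)
  open WeightedCounting using (module Greedy; module Counting)

  allVecs-unique : ∀ m k → Unique (allVecs m k)
  allVecs-unique zero    k = [] ∷ []
  allVecs-unique (suc m) k = subst Unique (sym (as-product (allVecs m k)))
    (Uniqueₚ.cartesianProductWith⁺ (λ v i → i Vec.∷ v) (λ eq → proj₂ (∷-injective eq) , proj₁ (∷-injective eq))
      (allVecs-unique m k) (Uniqueₚ.allFin⁺ k))
    where
    as-product : ∀ vs → concatMap (λ v → map (Vec._∷ v) (List.allFin k)) vs ≡ cartesianProductWith (λ v i → i Vec.∷ v) vs (List.allFin k)
    as-product []       = refl
    as-product (v ∷ vs) = cong (map (Vec._∷ v) (List.allFin k) List.++_) (as-product vs)

  -- Pigeonhole: g is injective, so if g (f i) ≠ i then g misses i, and deleting i from its range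
  -- injects `Fin (suc n)` into `Fin n`.
  rightInverse⇒leftInverse : ∀ {n} {f g : Fin n → Fin n} → (∀ j → f (g j) ≡ j) → ∀ i → g (f i) ≡ i
  rightInverse⇒leftInverse {suc n} {f} {g} fg i with g (f i) Finₚ.≟ i
  ... | yes gfi≡i = gfi≡i
  ... | no  gfi≢i = contradiction (injective⇒≤ avoid-injective) 1+n≰n
    where
    i≢g : ∀ k → i ≢ g k
    i≢g k refl = gfi≢i (cong g (fg k))
    avoid : Fin (suc n) → Fin n
    avoid k = punchOut (i≢g k)
    avoid-injective : ∀ {j k} → avoid j ≡ avoid k → j ≡ k
    avoid-injective {j} {k} eq = trans (sym (fg j)) (trans (cong f (punchOut-injective (i≢g j) (i≢g k) eq)) (fg k))

  %-≡⇒∣ : ∀ {m n} .{{_ : NonZero n}} d → m % n ≡ (m + d) % n → n ∣ d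
  %-≡⇒∣ {m} {n} d eq = ∣m+n∣m⇒∣n {m = m / n * n} (divides ((m + d) / n) (+-cancelˡ-≡ (m % n) _ _ (begin
    m % n + (m / n * n + d)            ≡⟨ +-assoc (m % n) _ d ⟨
    m % n + m / n * n + d              ≡⟨ cong (_+ d) (m≡m%n+[m/n]*n m n) ⟨
    m + d                              ≡⟨ m≡m%n+[m/n]*n (m + d) n ⟩
    (m + d) % n + (m + d) / n * n      ≡⟨ cong (_+ (m + d) / n * n) eq ⟨
    m % n + (m + d) / n * n            ∎))) (n∣m*n (m / n))
    where open ≡-Reasoning

  ∣<⇒≡0 : ∀ {n d} → n ∣ d → d < n → d ≡ 0
  ∣<⇒≡0 {n} {zero}  n∣d d<n = refl
  ∣<⇒≡0 {n} {suc d} n∣d d<n = contradiction n∣d (>⇒∤ d<n)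

  -- Only the difference is bounded, not a and b: the complements n - y take the value n at y = 0.
  +-%-cancelˡ-≤ : ∀ {n} .{{_ : NonZero n}} c {a b} → a ≤ b → b ∸ a < n → (c + a) % n ≡ (c + b) % n → a ≡ b
  +-%-cancelˡ-≤ {n} c {a} {b} a≤b b∸a<n eq = trans (sym (+-identityʳ a)) (trans (cong (a +_) (sym d≡0)) (m+[n∸m]≡n a≤b))
    where
    d≡0 : b ∸ a ≡ 0
    d≡0 = ∣<⇒≡0 (%-≡⇒∣ {c + a} (b ∸ a) (trans eq (cong (_% n) (trans (cong (c +_) (sym (m+[n∸m]≡n a≤b))) (sym (+-assoc c a (b ∸ a))))))) b∸a<n

  +-%-cancelˡ : ∀ {n} .{{_ : NonZero n}} c {a b} → b ∸ a < n → a ∸ b < n → (c + a) % n ≡ (c + b) % n → a ≡ b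
  +-%-cancelˡ c {a} {b} b∸a<n a∸b<n eq with ≤-total a b
  ... | inj₁ a≤b = +-%-cancelˡ-≤ c a≤b b∸a<n eq
  ... | inj₂ b≤a = sym (+-%-cancelˡ-≤ c b≤a a∸b<n (sym eq))

  +-%-cancelʳ : ∀ {n} .{{_ : NonZero n}} c {a b} → b ∸ a < n → a ∸ b < n → (a + c) % n ≡ (b + c) % n → a ≡ b
  +-%-cancelʳ c {a} {b} b∸a<n a∸b<n eq = +-%-cancelˡ c b∸a<n a∸b<n
    (trans (cong (_% _) (+-comm c a)) (trans eq (cong (_% _) (+-comm b c))))

  -- For n = 2c + 1 the number -c inverts 2 modulo n, because c · 2d + d = d · n.
  ∣double⇒∣ : ∀ {n d} c → n ≡ suc (c + c) → n ∣ d + d → n ∣ d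
  ∣double⇒∣ {n} {d} c n≡ n∣2d = ∣m+n∣m⇒∣n {m = c * (d + d)} (divides d (begin
    c * (d + d) + d      ≡⟨ solve 2 (λ c d → c :* (d :+ d) :+ d := d :* (con 1 :+ (c :+ c))) refl c d ⟩
    d * suc (c + c)      ≡⟨ cong (d *_) n≡ ⟨
    d * n                ∎)) (∣n⇒∣m*n c n∣2d)
    where
    open ≡-Reasoning
    open +-*-Solver

  double-%-injective-≤ : ∀ {n} .{{_ : NonZero n}} c → n ≡ suc (c + c) → ∀ {a b} → a ≤ b → b < n →
                         (a + a) % n ≡ (b + b) % n → a ≡ b
  double-%-injective-≤ {n} c n≡ {a} {b} a≤b b<n eq = trans (sym (+-identityʳ a)) (trans (cong (a +_) (sym d≡0)) (m+[n∸m]≡n a≤b))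
    where
    open +-*-Solver
    d = b ∸ a
    d≡0 : d ≡ 0
    d≡0 = ∣<⇒≡0 (∣double⇒∣ c n≡ (%-≡⇒∣ {a + a} (d + d) (trans eq (cong (_% n) (trans
      (cong (λ z → z + z) (sym (m+[n∸m]≡n a≤b)))
      (solve 2 (λ a d → (a :+ d) :+ (a :+ d) := (a :+ a) :+ (d :+ d)) refl a d)))))) (≤-<-trans (m∸n≤m b a) b<n)

  double-%-injective : ∀ {n} .{{_ : NonZero n}} c → n ≡ suc (c + c) → ∀ {a b} → a < n → b < n →
                       (a + a) % n ≡ (b + b) % n → a ≡ b
  double-%-injective c n≡ {a} {b} a<n b<n eq with ≤-total a b
  ... | inj₁ a≤b = double-%-injective-≤ c n≡ a≤b b<n eq
  ... | inj₂ b≤a = sym (double-%-injective-≤ c n≡ b≤a a<n (sym eq))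

  sum-toℕ : ∀ n → sum {n} toℕ + sum {n} toℕ + n ≡ n * n
  sum-toℕ zero    = refl
  sum-toℕ (suc n) = begin
    t + t + suc n                        ≡⟨ cong (λ z → z + z + suc n) (sum-suc n toℕ) ⟩
    (n + s) + (n + s) + suc n            ≡⟨ solve 2 (λ n s → (n :+ s) :+ (n :+ s) :+ (con 1 :+ n) := con 1 :+ n :+ (n :+ (s :+ s :+ n))) refl n s ⟩
    suc n + (n + (s + s + n))            ≡⟨ cong (λ z → suc n + (n + z)) (sum-toℕ n) ⟩
    suc n + (n + n * n)                  ≡⟨ cong (suc n +_) (*-suc n n) ⟨
    suc n + n * suc n                    ∎
    where
    open ≡-Reasoning
    open +-*-Solver
    s t : ℕ
    s = sum {n} toℕ
    t = sum {n} (suc ∘ toℕ)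
    sum-suc : ∀ k (f : Fin k → ℕ) → sum (suc ∘ f) ≡ k + sum f
    sum-suc zero    f = refl
    sum-suc (suc k) f = cong suc (trans (cong (f zero +_) (sum-suc k (f ∘ suc)))
      (solve 3 (λ a k s → a :+ (k :+ s) := k :+ (a :+ s)) refl (f zero) k (sum (f ∘ suc))))

  sum-surjective : ∀ {n} {f : Fin n → Fin n} → (∀ j → ∃ λ i → f i ≡ j) → sum (toℕ ∘ f) ≡ sum {n} toℕ
  sum-surjective {f = f} surj = sym (∑-permute toℕ
    (permutation f (λ j → proj₁ (surj j)) (λ j → proj₂ (surj j)) (rightInverse⇒leftInverse {f = f} (λ j → proj₂ (surj j)))))

  module _ {n} .{{_ : NonZero n}} where

    line : Fin 3 → Fin n → Fin n → Fin n
    line 0F i y = y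
    line 1F i y = (toℕ i + toℕ y) mod n
    line 2F i y = (toℕ i + (n ∸ toℕ y)) mod n

    toℕ-mod : ∀ m → toℕ (m mod n) ≡ m % n
    toℕ-mod m = toℕ-fromℕ< (m%n<n m n)

    mod≡⇒%≡ : ∀ {a b} → a mod n ≡ b mod n → a % n ≡ b % n
    mod≡⇒%≡ {a} {b} eq = trans (sym (toℕ-mod a)) (trans (cong toℕ eq) (toℕ-mod b))

    toℕ∸<n : ∀ (i j : Fin n) → toℕ i ∸ toℕ j < n
    toℕ∸<n i j = ≤-<-trans (m∸n≤m (toℕ i) (toℕ j)) (toℕ<n i)

    complement∸<n : ∀ (i j : Fin n) → (n ∸ toℕ i) ∸ (n ∸ toℕ j) < n
    complement∸<n i j = ≤-<-trans (∸-monoˡ-≤ (n ∸ toℕ j) (m∸n≤m n (toℕ i)))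
      (subst (_< n) (sym (m∸[m∸n]≡n (<⇒≤ (toℕ<n j)))) (toℕ<n j))

    line-injectiveʳ : ∀ c {i y z} → line c i y ≡ line c i z → y ≡ z
    line-injectiveʳ 0F eq = eq
    line-injectiveʳ 1F {i} {y} {z} eq = toℕ-injective (+-%-cancelˡ (toℕ i) (toℕ∸<n z y) (toℕ∸<n y z) (mod≡⇒%≡ {toℕ i + toℕ y} eq))
    line-injectiveʳ 2F {i} {y} {z} eq = toℕ-injective (∸-cancelˡ-≡ (<⇒≤ (toℕ<n y)) (<⇒≤ (toℕ<n z))
      (+-%-cancelˡ (toℕ i) (complement∸<n z y) (complement∸<n y z) (mod≡⇒%≡ {toℕ i + (n ∸ toℕ y)} eq)))

    line-surjective : ∀ (v : Vec (Fin n) n) → IsToroidal v → ∀ c j → ∃ λ i → line c i (lookup v i) ≡ j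
    line-surjective v (cols , _ , _) 0F j = cols j
    line-surjective v (_ , sums , _) 1F j = let i , eq = sums j in i , toℕ-injective (trans (toℕ-mod (toℕ i + toℕ (lookup v i))) eq)
    line-surjective v (_ , _ , diffs) 2F j = let i , eq = diffs j in i , toℕ-injective (trans (toℕ-mod (toℕ i + (n ∸ toℕ (lookup v i)))) eq)

    -- Summing x + f x ≡ g x (mod n), with f and g permutations, shows that n divides 0 + 1 + … + (n − 1).
    toroidal⇒odd : ∀ (v : Vec (Fin n) n) → IsToroidal v → ∃ λ c → n ≡ suc (c + c)
    toroidal⇒odd v tor = q , sym (*-cancelʳ-≡ (suc (q + q)) n n (begin
      suc (q + q) * n     ≡⟨ solve 2 (λ q n → (con 1 :+ (q :+ q)) :* n := q :* n :+ q :* n :+ n) refl q n ⟩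
      q * n + q * n + n   ≡⟨ cong (λ z → z + z + n) s≡q*n ⟨
      s + s + n           ≡⟨ sum-toℕ n ⟩
      n * n               ∎))
      where
      open ≡-Reasoning
      open +-*-Solver
      s q : ℕ
      s = sum {n} toℕ
      m : Fin n → ℕ
      m i = toℕ i + toℕ (lookup v i)
      q = sum λ i → m i / n
      s≡q*n : s ≡ q * n
      s≡q*n = +-cancelˡ-≡ s s (q * n) (begin
        s + s                                        ≡⟨ cong (s +_) (sum-surjective (line-surjective v tor 0F)) ⟨
        s + sum (toℕ ∘ lookup v)                     ≡⟨ ∑-distrib-+ toℕ (toℕ ∘ lookup v) ⟨
        sum m                                        ≡⟨ sum-cong-≗ (λ i → m≡m%n+[m/n]*n (m i) n) ⟩
        sum (λ i → m i % n + m i / n * n)            ≡⟨ ∑-distrib-+ (λ i → m i % n) (λ i → m i / n * n) ⟩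
        sum (λ i → m i % n) + sum (λ i → m i / n * n) ≡⟨ cong₂ _+_ (sum-cong-≗ (λ i → sym (toℕ-mod (m i)))) (sym (*-distribʳ-sum n (λ i → m i / n))) ⟩
        sum (λ i → toℕ (m i mod n)) + q * n          ≡⟨ cong (_+ q * n) (sum-surjective (line-surjective v tor 1F)) ⟩
        s + q * n                                    ∎)

    module _ c (n≡ : n ≡ suc (c + c)) where

      -- The two diagonal labels of a cell add up to 2i modulo n, the column cancelling through y +
      -- (n - y) = n. Since n is odd, 2i determines i.
      diagonals-meet-once : ∀ i j y z → line 1F i y ≡ line 1F j z → line 2F i y ≡ line 2F j z → i ≡ j
      diagonals-meet-once i j y z eq eq′ = toℕ-injective (double-%-injective c n≡ (toℕ<n i) (toℕ<n j) (begin
        (toℕ i + toℕ i) % n             ≡⟨ double i y ⟩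
        (p i y % n + d i y % n) % n     ≡⟨ cong₂ (λ a b → (a + b) % n) (mod≡⇒%≡ {p i y} eq) (mod≡⇒%≡ {d i y} eq′) ⟩
        (p j z % n + d j z % n) % n     ≡⟨ double j z ⟨
        (toℕ j + toℕ j) % n             ∎))
        where
        open ≡-Reasoning
        open +-*-Solver
        p d : Fin n → Fin n → ℕ
        p i y = toℕ i + toℕ y
        d i y = toℕ i + (n ∸ toℕ y)
        double : ∀ i y → (toℕ i + toℕ i) % n ≡ (p i y % n + d i y % n) % n
        double i y = begin
          (toℕ i + toℕ i) % n                       ≡⟨ [m+n]%n≡m%n (toℕ i + toℕ i) n ⟨
          (toℕ i + toℕ i + n) % n                   ≡⟨ cong (λ z → (toℕ i + toℕ i + z) % n) (m+[n∸m]≡n (<⇒≤ (toℕ<n y))) ⟨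
          (toℕ i + toℕ i + (toℕ y + (n ∸ toℕ y))) % n ≡⟨ cong (_% n) (solve 3 (λ i y u → i :+ i :+ (y :+ u) := (i :+ y) :+ (i :+ u)) refl (toℕ i) (toℕ y) (n ∸ toℕ y)) ⟩
          (p i y + d i y) % n                       ≡⟨ %-distribˡ-+ (p i y) (d i y) n ⟩
          (p i y % n + d i y % n) % n               ∎

      column-meets-once : ∀ k → 0F ≢ k → ∀ i j y → line k i y ≡ line k j y → i ≡ j
      column-meets-once 0F 0≢k i j y eq = contradiction refl 0≢k
      column-meets-once 1F 0≢k i j y eq =
        toℕ-injective (+-%-cancelʳ (toℕ y) (toℕ∸<n j i) (toℕ∸<n i j) (mod≡⇒%≡ {toℕ i + toℕ y} eq))
      column-meets-once 2F 0≢k i j y eq =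
        toℕ-injective (+-%-cancelʳ (n ∸ toℕ y) (toℕ∸<n j i) (toℕ∸<n i j) (mod≡⇒%≡ {toℕ i + (n ∸ toℕ y)} eq))

      lines-meet-once : ∀ k l → k ≢ l → ∀ i j y z → line k i y ≡ line k j z → line l i y ≡ line l j z → i ≡ j
      lines-meet-once 0F l  k≢l i j y z refl eq′ = column-meets-once l k≢l i j y eq′
      lines-meet-once k  0F k≢l i j y z eq refl  = column-meets-once k (k≢l ∘ sym) i j y eq
      lines-meet-once 1F 2F k≢l i j y z eq eq′   = diagonals-meet-once i j y z eq eq′
      lines-meet-once 2F 1F k≢l i j y z eq eq′   = diagonals-meet-once i j y z eq′ eq
      lines-meet-once 1F 1F k≢l i j y z eq eq′   = contradiction refl k≢l
      lines-meet-once 2F 2F k≢l i j y z eq eq′   = contradiction refl k≢l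

    module _ (4≤n : 4 ≤ n) where

      open Counting 4≤n line

      open Greedy line a 0≤a using (Valid)

      toroidal⇒valid : ∀ (v : Vec (Fin n) n) → IsToroidal v → Valid (lookup v)
      toroidal⇒valid v tor c {i} {j} eq = trans (sym (inverse i)) (trans (cong g eq) (inverse j))
        where
        g : Fin n → Fin n
        g j = proj₁ (line-surjective v tor c j)
        inverse : ∀ i → g (line c i (lookup v i)) ≡ i
        inverse = rightInverse⇒leftInverse {f = λ i → line c i (lookup v i)} (λ j → proj₂ (line-surjective v tor c j))

      -- Surjectivity on each line family supplies the attackers. An attacker in row i would share a
      -- line and a row with (i, y), forcing its column to be y. If two attackers were in the same
      -- row, that queen would lie on two lines through (i, y); these meet in row i only, which is
      -- the previous case.
      toroidal⇒hasAttackers : ∀ (v : Vec (Fin n) n) → IsToroidal v → HasAttackers (lookup v)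
      toroidal⇒hasAttackers v tor = att , att-line , unique
        where
        att : Fin 3 → Fin n → Fin n → Fin n
        att c i y = proj₁ (line-surjective v tor c (line c i y))
        att-line : ∀ c i y → line c (att c i y) (lookup v (att c i y)) ≡ line c i y
        att-line c i y = proj₂ (line-surjective v tor c (line c i y))
        i≢att : ∀ i y → lookup v i ≢ y → ∀ c → i ≢ att c i y
        i≢att i y vi≢y c i≡ = vi≢y (line-injectiveʳ c {i}
          (trans (cong (λ r → line c r (lookup v r)) i≡) (att-line c i y)))
        att≢att : ∀ i y → lookup v i ≢ y → ∀ c d → c ≢ d → att c i y ≢ att d i y
        att≢att i y vi≢y c d c≢d eq = i≢att i y vi≢y c (sym (lines-meet-once half n≡ c d c≢d
          (att c i y) i (lookup v (att c i y)) y
          (att-line c i y) (trans (cong (λ r → line d r (lookup v r)) eq) (att-line d i y))))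
          where
          half : ℕ
          half = proj₁ (toroidal⇒odd v tor)
          n≡ : n ≡ suc (half + half)
          n≡ = proj₂ (toroidal⇒odd v tor)
        unique : ∀ {i y} → lookup v i ≢ y → Unique (i ∷ att 0F i y ∷ att 1F i y ∷ att 2F i y ∷ [])
        unique {i} {y} vi≢y =
          (i≢att i y vi≢y 0F ∷ i≢att i y vi≢y 1F ∷ i≢att i y vi≢y 2F ∷ []) ∷
          (att≢att i y vi≢y 0F 1F (λ ()) ∷ att≢att i y vi≢y 0F 2F (λ ()) ∷ []) ∷
          (att≢att i y vi≢y 1F 2F (λ ()) ∷ []) ∷ [] ∷ []

      toroidal-count : length (filter isToroidal? (allVecs n n)) * ((n ∸ 2) * (n ∸ 3)) ^ n ≤ cubicProduct ((n ∸ 2) * (n ∸ 3)) n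
      toroidal-count = length*D^≤cubicProduct (filter isToroidal? (allVecs n n)) (Uniqueₚ.filter⁺ isToroidal? (allVecs-unique n n))
        (λ {v} v∈ → toroidal⇒valid v (is-toroidal v∈)) (λ {v} v∈ → toroidal⇒hasAttackers v (is-toroidal v∈))
        where
        is-toroidal : ∀ {v} → v ∈ filter isToroidal? (allVecs n n) → IsToroidal v
        is-toroidal v∈ = proj₂ (∈-filter⁻ isToroidal? {xs = allVecs n n} v∈)

  T-bound : ∀ n → 4 ≤ n → T n * ((n ∸ 2) * (n ∸ 3)) ^ n ≤ cubicProduct ((n ∸ 2) * (n ∸ 3)) n
  T-bound (suc n) 4≤n = toroidal-count 4≤n

-- Partial sums of the exponential series.

module ErrorTerm where

  open import Data.Rational
  open import Data.Rational.Properties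
  open import Data.Rational.Solver using (module +-*-Solver)
  open +-*-Solver
  open NaturalBounds using (module Asymptotics)
  open WeightedCounting
  open TorusLines using (T-bound)

  0<ℕ→ℚ : ∀ m .{{_ : ℕ.NonZero m}} → 0ℚ < ℕ→ℚ m
  0<ℕ→ℚ (suc m) = 0<ℕ→ℚ-suc m

  *-cancelˡ-≤-0< : ∀ r {p q} → 0ℚ < r → r * p ≤ r * q → p ≤ q
  *-cancelˡ-≤-0< r 0<r = *-cancelˡ-≤-pos r {{positive 0<r}}

  /-*-cancel : ∀ a m .{{_ : ℕ.NonZero m}} → (ℤ.+ a / m) * ℕ→ℚ m ≡ ℕ→ℚ a
  /-*-cancel a (suc m) = toℚᵘ-injective (begin
    toℚᵘ ((ℤ.+ a / suc m) * ℕ→ℚ (suc m))               ≈⟨ toℚᵘ-homo-* (ℤ.+ a / suc m) (ℕ→ℚ (suc m)) ⟩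
    toℚᵘ (ℤ.+ a / suc m) ℚᵘ.* toℚᵘ (ℕ→ℚ (suc m))       ≈⟨ ℚᵘₚ.*-cong (toℚᵘ-fromℚᵘ (ℚᵘ.mkℚᵘ (ℤ.+ a) m)) (toℚᵘ-ℕ→ℚ (suc m)) ⟩
    ℚᵘ.mkℚᵘ (ℤ.+ a) m ℚᵘ.* ℚᵘ.mkℚᵘ (ℤ.+ suc m) 0         ≈⟨ ℚᵘ.*≡* (trans (ℤₚ.*-identityʳ (ℤ.+ a ℤ.* ℤ.+ suc m)) (cong (λ z → ℤ.+ a ℤ.* ℤ.+ z) (sym (ℕₚ.*-identityʳ (suc m))))) ⟩
    ℚᵘ.mkℚᵘ (ℤ.+ a) 0                                  ≈⟨ toℚᵘ-ℕ→ℚ a ⟨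
    toℚᵘ (ℕ→ℚ a)                                     ∎)
    where open ℚᵘₚ.≃-Reasoning

  ℕ→ℚ-^ : ∀ a k → ℕ→ℚ (a ℕ.^ k) ≡ ℕ→ℚ a ^ℚ k
  ℕ→ℚ-^ a zero    = refl
  ℕ→ℚ-^ a (suc k) = trans (ℕ→ℚ-* a (a ℕ.^ k)) (cong (ℕ→ℚ a *_) (ℕ→ℚ-^ a k))

  ^ℚ-distrib-* : ∀ p q k → (p * q) ^ℚ k ≡ p ^ℚ k * q ^ℚ k
  ^ℚ-distrib-* p q zero    = refl
  ^ℚ-distrib-* p q (suc k) = trans (cong (p * q *_) (^ℚ-distrib-* p q k))
    (solve 4 (λ p q x y → p :* q :* (x :* y) := p :* x :* (q :* y)) refl p q (p ^ℚ k) (q ^ℚ k))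

  module ExpPartial (N : ℕ) .{{_ : ℕ.NonZero N}} where

    term : ℕ → ℚ
    term k = (ℤ.+ (N ℕ.^ k) / (k !)) {{k ℕₚ.!≢0}}

    term*! : ∀ k → term k * ℕ→ℚ (k !) ≡ ℕ→ℚ (N ℕ.^ k)
    term*! k = /-*-cancel (N ℕ.^ k) (k !) {{k ℕₚ.!≢0}}

    0<! : ∀ k → 0ℚ < ℕ→ℚ (k !)
    0<! k = 0<ℕ→ℚ (k !) {{k ℕₚ.!≢0}}

    [k+j]!≤ : ∀ k j {M} → k ℕ.+ j ℕ.≤ M → (k ℕ.+ j) ! ℕ.≤ k ! ℕ.* M ℕ.^ j
    [k+j]!≤ k zero    {M} _ = ℕₚ.≤-reflexive (trans (cong _! (ℕₚ.+-identityʳ k)) (sym (ℕₚ.*-identityʳ (k !))))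
    [k+j]!≤ k (suc j) {M} k+j<M rewrite ℕₚ.+-suc k j = begin
      suc (k ℕ.+ j) ℕ.* (k ℕ.+ j) !      ≤⟨ ℕₚ.*-mono-≤ k+j<M ([k+j]!≤ k j (ℕₚ.<⇒≤ k+j<M)) ⟩
      M ℕ.* (k ! ℕ.* M ℕ.^ j)            ≡⟨ S.solve 3 (λ m f e → m S.:* (f S.:* e) S.:= f S.:* (m S.:* e)) refl M (k !) (M ℕ.^ j) ⟩
      k ! ℕ.* (M ℕ.* M ℕ.^ j)            ∎
      where
      open ℕₚ.≤-Reasoning
      module S = ℕSolver.+-*-Solver

    N^j*N!≤ : ∀ j → N ℕ.^ j ℕ.* N ! ℕ.≤ (N ℕ.+ j) !
    N^j*N!≤ zero    = ℕₚ.≤-reflexive (trans (ℕₚ.+-identityʳ (N !)) (cong _! (sym (ℕₚ.+-identityʳ N))))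
    N^j*N!≤ (suc j) rewrite ℕₚ.+-suc N j = begin
      N ℕ.* N ℕ.^ j ℕ.* N !         ≡⟨ ℕₚ.*-assoc N (N ℕ.^ j) (N !) ⟩
      N ℕ.* (N ℕ.^ j ℕ.* N !)       ≤⟨ ℕₚ.*-mono-≤ (ℕₚ.≤-trans (ℕₚ.m≤m+n N j) (ℕₚ.n≤1+n (N ℕ.+ j))) (N^j*N!≤ j) ⟩
      suc (N ℕ.+ j) ℕ.* (N ℕ.+ j) ! ∎
      where open ℕₚ.≤-Reasoning

    -- The terms N^k/k! have successive ratios N/(k + 1), so they peak at k = N; this is that fact
    -- with denominators cleared, on either side of the peak.
    power*!≤ : ∀ k → N ℕ.^ k ℕ.* N ! ℕ.≤ k ! ℕ.* N ℕ.^ N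
    power*!≤ k with ℕₚ.≤-total k N
    ... | inj₁ k≤N = begin
      N ℕ.^ k ℕ.* N !                       ≡⟨ cong (λ z → N ℕ.^ k ℕ.* z !) (ℕₚ.m+[n∸m]≡n k≤N) ⟨
      N ℕ.^ k ℕ.* (k ℕ.+ (N ∸ k)) !         ≤⟨ ℕₚ.*-monoʳ-≤ (N ℕ.^ k) ([k+j]!≤ k (N ∸ k) (ℕₚ.≤-reflexive (ℕₚ.m+[n∸m]≡n k≤N))) ⟩
      N ℕ.^ k ℕ.* (k ! ℕ.* N ℕ.^ (N ∸ k))   ≡⟨ S.solve 3 (λ a f b → a S.:* (f S.:* b) S.:= f S.:* (a S.:* b)) refl (N ℕ.^ k) (k !) (N ℕ.^ (N ∸ k)) ⟩
      k ! ℕ.* (N ℕ.^ k ℕ.* N ℕ.^ (N ∸ k))   ≡⟨ cong (k ! ℕ.*_) (ℕₚ.^-distribˡ-+-* N k (N ∸ k)) ⟨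
      k ! ℕ.* N ℕ.^ (k ℕ.+ (N ∸ k))         ≡⟨ cong (λ z → k ! ℕ.* N ℕ.^ z) (ℕₚ.m+[n∸m]≡n k≤N) ⟩
      k ! ℕ.* N ℕ.^ N                       ∎
      where
      open ℕₚ.≤-Reasoning
      module S = ℕSolver.+-*-Solver
    ... | inj₂ N≤k = begin
      N ℕ.^ k ℕ.* N !                             ≡⟨ cong (λ z → N ℕ.^ z ℕ.* N !) (ℕₚ.m+[n∸m]≡n N≤k) ⟨
      N ℕ.^ (N ℕ.+ (k ∸ N)) ℕ.* N !               ≡⟨ cong (ℕ._* N !) (ℕₚ.^-distribˡ-+-* N N (k ∸ N)) ⟩
      N ℕ.^ N ℕ.* N ℕ.^ (k ∸ N) ℕ.* N !           ≡⟨ ℕₚ.*-assoc (N ℕ.^ N) (N ℕ.^ (k ∸ N)) (N !) ⟩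
      N ℕ.^ N ℕ.* (N ℕ.^ (k ∸ N) ℕ.* N !)         ≤⟨ ℕₚ.*-monoʳ-≤ (N ℕ.^ N) (N^j*N!≤ (k ∸ N)) ⟩
      N ℕ.^ N ℕ.* (N ℕ.+ (k ∸ N)) !               ≡⟨ cong (λ z → N ℕ.^ N ℕ.* z !) (ℕₚ.m+[n∸m]≡n N≤k) ⟩
      N ℕ.^ N ℕ.* k !                             ≡⟨ ℕₚ.*-comm (N ℕ.^ N) (k !) ⟩
      k ! ℕ.* N ℕ.^ N                             ∎
      where open ℕₚ.≤-Reasoning

    M : ℚ
    M = ℕ→ℚ (N ℕ.^ N) * inv (ℕ→ℚ (N !))

    M*! : M * ℕ→ℚ (N !) ≡ ℕ→ℚ (N ℕ.^ N)
    M*! = trans (solve 3 (λ a i f → a :* i :* f := a :* (f :* i)) refl (ℕ→ℚ (N ℕ.^ N)) (inv (ℕ→ℚ (N !))) (ℕ→ℚ (N !)))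
      (trans (cong (ℕ→ℚ (N ℕ.^ N) *_) (*-inv (0<! N))) (*-identityʳ (ℕ→ℚ (N ℕ.^ N))))

    0≤M : 0ℚ ≤ M
    0≤M = *-nonNeg (ℕ→ℚ-nonNeg (N ℕ.^ N)) (inv-nonNeg (ℕ→ℚ-nonNeg (N !)))

    term≤M : ∀ k → term k ≤ M
    term≤M k = *-cancelˡ-≤-0< (ℕ→ℚ (N !)) (0<! N) (*-cancelˡ-≤-0< (ℕ→ℚ (k !)) (0<! k) (begin
      K * (F * term k)                 ≡⟨ solve 3 (λ k f t → k :* (f :* t) := t :* k :* f) refl K F (term k) ⟩
      term k * K * F                   ≡⟨ cong (_* F) (term*! k) ⟩
      ℕ→ℚ (N ℕ.^ k) * F                ≡⟨ ℕ→ℚ-* (N ℕ.^ k) (N !) ⟨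
      ℕ→ℚ (N ℕ.^ k ℕ.* N !)            ≤⟨ ℕ→ℚ-mono-≤ (power*!≤ k) ⟩
      ℕ→ℚ (k ! ℕ.* N ℕ.^ N)            ≡⟨ ℕ→ℚ-* (k !) (N ℕ.^ N) ⟩
      K * ℕ→ℚ (N ℕ.^ N)                ≡⟨ cong (K *_) (trans (*-comm F M) M*!) ⟨
      K * (F * M)                      ∎))
      where
      open ≤-Reasoning
      K F : ℚ
      K = ℕ→ℚ (k !)
      F = ℕ→ℚ (N !)

    term-suc : ∀ k → ℕ→ℚ (suc k) * term (suc k) ≡ ℕ→ℚ N * term k
    term-suc k = ≤-antisym (cancel (≤-reflexive eq)) (cancel (≤-reflexive (sym eq)))
      where
      K : ℚ
      K = ℕ→ℚ (k !)
      cancel : ∀ {p q} → K * p ≤ K * q → p ≤ q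
      cancel = *-cancelˡ-≤-0< K (0<! k)
      eq : K * (ℕ→ℚ (suc k) * term (suc k)) ≡ K * (ℕ→ℚ N * term k)
      eq = begin
        K * (ℕ→ℚ (suc k) * term (suc k))   ≡⟨ solve 3 (λ K s t → K :* (s :* t) := t :* (s :* K)) refl K (ℕ→ℚ (suc k)) (term (suc k)) ⟩
        term (suc k) * (ℕ→ℚ (suc k) * K)   ≡⟨ cong (term (suc k) *_) (ℕ→ℚ-* (suc k) (k !)) ⟨
        term (suc k) * ℕ→ℚ (suc k !)       ≡⟨ term*! (suc k) ⟩
        ℕ→ℚ (N ℕ.* N ℕ.^ k)                ≡⟨ ℕ→ℚ-* N (N ℕ.^ k) ⟩
        ℕ→ℚ N * ℕ→ℚ (N ℕ.^ k)              ≡⟨ cong (ℕ→ℚ N *_) (term*! k) ⟨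
        ℕ→ℚ N * (term k * K)               ≡⟨ solve 3 (λ n t K → n :* (t :* K) := K :* (n :* t)) refl (ℕ→ℚ N) (term k) K ⟩
        K * (ℕ→ℚ N * term k)               ∎
        where open ≡-Reasoning

    term-nonNeg : ∀ k → 0ℚ ≤ term k
    term-nonNeg k = *-cancelˡ-≤-0< (ℕ→ℚ (k !)) (0<! k) (begin
      ℕ→ℚ (k !) * 0ℚ          ≡⟨ *-zeroʳ (ℕ→ℚ (k !)) ⟩
      0ℚ                      ≤⟨ ℕ→ℚ-nonNeg (N ℕ.^ k) ⟩
      ℕ→ℚ (N ℕ.^ k)           ≡⟨ trans (*-comm (ℕ→ℚ (k !)) (term k)) (term*! k) ⟨
      ℕ→ℚ (k !) * term k      ∎)
      where open ≤-Reasoning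

    term-halves : ∀ k → N ℕ.+ N ℕ.≤ suc k → term (suc k) + term (suc k) ≤ term k
    term-halves k 2N≤ = *-cancelˡ-≤-0< (ℕ→ℚ N) (0<ℕ→ℚ N) (begin
      ℕ→ℚ N * (t + t)               ≡⟨ solve 2 (λ n t → n :* (t :+ t) := (n :+ n) :* t) refl (ℕ→ℚ N) t ⟩
      (ℕ→ℚ N + ℕ→ℚ N) * t           ≡⟨ cong (_* t) (ℕ→ℚ-+ N N) ⟨
      ℕ→ℚ (N ℕ.+ N) * t             ≤⟨ *ʳ-mono-≤ (term-nonNeg (suc k)) (ℕ→ℚ-mono-≤ 2N≤) ⟩
      ℕ→ℚ (suc k) * t               ≡⟨ term-suc k ⟩
      ℕ→ℚ N * term k                ∎)
      where
      open ≤-Reasoning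
      t : ℚ
      t = term (suc k)

    expPartial-≤ : ∀ K → expPartial N K ≤ ℕ→ℚ (suc K) * M
    expPartial-≤ zero    = ≤-trans (term≤M 0) (≤-reflexive (sym (*-identityˡ M)))
    expPartial-≤ (suc K) = begin
      expPartial N K + term (suc K)   ≤⟨ +-mono-≤ (expPartial-≤ K) (term≤M (suc K)) ⟩
      ℕ→ℚ (suc K) * M + M             ≡⟨ solve 2 (λ s m → s :* m :+ m := (con 1ℚ :+ s) :* m) refl (ℕ→ℚ (suc K)) M ⟩
      (1ℚ + ℕ→ℚ (suc K)) * M          ≡⟨ cong (_* M) (ℕ→ℚ-suc (suc K)) ⟨
      ℕ→ℚ (suc (suc K)) * M           ∎
      where open ≤-Reasoning

    -- Beyond 2N each term is at most half its predecessor, so the tail is bounded by its first term.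
    expPartial-tail : ∀ j → expPartial N (N ℕ.+ N ℕ.+ j) + term (N ℕ.+ N ℕ.+ j) ≤ ℕ→ℚ (2 ℕ.+ (N ℕ.+ N)) * M
    expPartial-tail zero rewrite ℕₚ.+-identityʳ (N ℕ.+ N) = begin
      expPartial N 2N + term 2N       ≤⟨ +-mono-≤ (expPartial-≤ 2N) (term≤M 2N) ⟩
      ℕ→ℚ (suc 2N) * M + M            ≡⟨ solve 2 (λ s m → s :* m :+ m := (con 1ℚ :+ s) :* m) refl (ℕ→ℚ (suc 2N)) M ⟩
      (1ℚ + ℕ→ℚ (suc 2N)) * M         ≡⟨ cong (_* M) (ℕ→ℚ-suc (suc 2N)) ⟨
      ℕ→ℚ (suc (suc 2N)) * M          ∎
      where
      open ≤-Reasoning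
      2N : ℕ
      2N = N ℕ.+ N
    expPartial-tail (suc j) rewrite ℕₚ.+-suc (N ℕ.+ N) j = begin
      expPartial N k + t + t          ≡⟨ +-assoc (expPartial N k) t t ⟩
      expPartial N k + (t + t)        ≤⟨ +-monoʳ-≤ (expPartial N k) (term-halves k (ℕₚ.≤-trans (ℕₚ.m≤m+n (N ℕ.+ N) j) (ℕₚ.n≤1+n k))) ⟩
      expPartial N k + term k         ≤⟨ expPartial-tail j ⟩
      ℕ→ℚ (2 ℕ.+ (N ℕ.+ N)) * M       ∎
      where
      open ≤-Reasoning
      k : ℕ
      k = N ℕ.+ N ℕ.+ j
      t : ℚ
      t = term (suc k)

    -- Up to index 2N there are at most 2N + 1 terms, each at most `M`, and the geometric tail costs
    -- one more `M`. The bound is uniform in K and replaces e^N; N = 3n gives the factor 6n + 2.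
    expPartial-bound : ∀ K → expPartial N K ≤ ℕ→ℚ (2 ℕ.+ (N ℕ.+ N)) * M
    expPartial-bound K with ℕₚ.≤-total K (N ℕ.+ N)
    ... | inj₁ K≤2N = ≤-trans (expPartial-≤ K) (*ʳ-mono-≤ 0≤M (ℕ→ℚ-mono-≤ (ℕ.s≤s (ℕₚ.≤-trans K≤2N (ℕₚ.n≤1+n _)))))
    ... | inj₂ 2N≤K = subst (λ k → expPartial N k ≤ ℕ→ℚ (2 ℕ.+ (N ℕ.+ N)) * M) (ℕₚ.m+[n∸m]≡n 2N≤K) (begin
      expPartial N k             ≡⟨ +-identityʳ (expPartial N k) ⟨
      expPartial N k + 0ℚ        ≤⟨ +-monoʳ-≤ (expPartial N k) (term-nonNeg k) ⟩
      expPartial N k + term k    ≤⟨ expPartial-tail (K ∸ (N ℕ.+ N)) ⟩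
      ℕ→ℚ (2 ℕ.+ (N ℕ.+ N)) * M  ∎)
      where
      open ≤-Reasoning
      k : ℕ
      k = N ℕ.+ N ℕ.+ (K ∸ (N ℕ.+ N))

    expPartial*! : ∀ K → expPartial N K * ℕ→ℚ (N !) ≤ ℕ→ℚ ((2 ℕ.+ (N ℕ.+ N)) ℕ.* N ℕ.^ N)
    expPartial*! K = begin
      expPartial N K * ℕ→ℚ (N !)                       ≤⟨ *ʳ-mono-≤ (ℕ→ℚ-nonNeg (N !)) (expPartial-bound K) ⟩
      ℕ→ℚ (2 ℕ.+ (N ℕ.+ N)) * M * ℕ→ℚ (N !)            ≡⟨ *-assoc (ℕ→ℚ (2 ℕ.+ (N ℕ.+ N))) M (ℕ→ℚ (N !)) ⟩
      ℕ→ℚ (2 ℕ.+ (N ℕ.+ N)) * (M * ℕ→ℚ (N !))          ≡⟨ cong (ℕ→ℚ (2 ℕ.+ (N ℕ.+ N)) *_) M*! ⟩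
      ℕ→ℚ (2 ℕ.+ (N ℕ.+ N)) * ℕ→ℚ (N ℕ.^ N)            ≡⟨ ℕ→ℚ-* (2 ℕ.+ (N ℕ.+ N)) (N ℕ.^ N) ⟨
      ℕ→ℚ ((2 ℕ.+ (N ℕ.+ N)) ℕ.* N ℕ.^ N)              ∎
      where open ≤-Reasoning

  -- Choice of d for each n, and the error term.

  blockCount : ℕ → ℕ → ℕ
  blockCount n k = n DivMod./ ((3 ℕ.+ k) ℕ.* (3 ℕ.+ k))

  -- The size conditions under which Asymptotics applies with d = 3 + k and t = ⌊n / d²⌋.
  Good : ℕ → ℕ → Set
  Good n k = 40 ℕ.* (n ℕ.* n) ℕ.≤ blockCount n k ℕ.* blockCount n k ℕ.* blockCount n k × 5 ℕ.* (4 ℕ.+ k) ℕ.≤ n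

  good? : ∀ n k → Dec (Good n k)
  good? n k = (40 ℕ.* (n ℕ.* n) ℕ.≤? blockCount n k ℕ.* blockCount n k ℕ.* blockCount n k) ×-dec (5 ℕ.* (4 ℕ.+ k) ℕ.≤? n)

  -- The largest d = 3 + k with k < b and Good n k; 0 means that there is none.
  precision : ℕ → ℕ → ℕ
  precision n zero    = 0
  precision n (suc b) with good? n b
  ... | yes _ = 3 ℕ.+ b
  ... | no _  = precision n b

  precision-good : ∀ n b → precision n b ≡ 0 ⊎ ∃ λ k → precision n b ≡ 3 ℕ.+ k × Good n k
  precision-good n zero    = inj₁ refl
  precision-good n (suc b) with good? n b
  ... | yes good = inj₂ (b , refl , good)
  ... | no _     = precision-good n b

  precision-max : ∀ {n k} b → k ℕ.< b → Good n k → 3 ℕ.+ k ℕ.≤ precision n b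
  precision-max {n} {k} (suc b) k<1+b good with good? n b
  ... | yes _    = ℕₚ.+-monoʳ-≤ 3 (ℕ.s≤s⁻¹ k<1+b)
  ... | no ¬good = precision-max b (ℕₚ.≤∧≢⇒< (ℕ.s≤s⁻¹ k<1+b) (λ { refl → ¬good good })) good

  -- With s = d², the threshold 160s³ gives t ≥ 160s², while flooring loses at most a factor 2, n ≤
  -- 2ts. Then 40n² ≤ 160t²s² ≤ t³.
  good-eventually : ∀ k {n} → (3 ℕ.+ k) ℕ.* (3 ℕ.+ k) ℕ.* (160 ℕ.* ((3 ℕ.+ k) ℕ.* (3 ℕ.+ k) ℕ.* ((3 ℕ.+ k) ℕ.* (3 ℕ.+ k)))) ℕ.≤ n → Good n k
  good-eventually k {n} N≤n = cubic , linear
    where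
    open ℕₚ.≤-Reasoning
    module S = ℕSolver.+-*-Solver
    d s t : ℕ
    d = 3 ℕ.+ k
    s = d ℕ.* d
    t = blockCount n k
    160s²≤t : 160 ℕ.* (s ℕ.* s) ℕ.≤ t
    160s²≤t = begin
      160 ℕ.* (s ℕ.* s)                            ≡⟨ DivMod.m*n/n≡m (160 ℕ.* (s ℕ.* s)) s ⟨
      (160 ℕ.* (s ℕ.* s) ℕ.* s) DivMod./ s         ≡⟨ cong (DivMod._/ s) (ℕₚ.*-comm (160 ℕ.* (s ℕ.* s)) s) ⟩
      (s ℕ.* (160 ℕ.* (s ℕ.* s))) DivMod./ s       ≤⟨ DivMod./-monoˡ-≤ s N≤n ⟩
      t                                            ∎
    1≤t : 1 ℕ.≤ t
    1≤t = ℕₚ.≤-trans (ℕₚ.*-mono-≤ {1} {160} {1} {s ℕ.* s} (ℕ.s≤s ℕ.z≤n) (ℕ.s≤s ℕ.z≤n)) 160s²≤t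
    n≤2ts : n ℕ.≤ (t ℕ.+ t) ℕ.* s
    n≤2ts = begin
      n                    ≡⟨ DivMod.m≡m%n+[m/n]*n n s ⟩
      n DivMod.% s ℕ.+ t ℕ.* s  ≤⟨ ℕₚ.+-monoˡ-≤ (t ℕ.* s) (ℕₚ.<⇒≤ (DivMod.m%n<n n s)) ⟩
      suc t ℕ.* s          ≤⟨ ℕₚ.*-monoˡ-≤ s (ℕₚ.+-monoˡ-≤ t 1≤t) ⟩
      (t ℕ.+ t) ℕ.* s      ∎
    cubic : 40 ℕ.* (n ℕ.* n) ℕ.≤ t ℕ.* t ℕ.* t
    cubic = begin
      40 ℕ.* (n ℕ.* n)                                       ≤⟨ ℕₚ.*-monoʳ-≤ 40 (ℕₚ.*-mono-≤ n≤2ts n≤2ts) ⟩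
      40 ℕ.* ((t ℕ.+ t) ℕ.* s ℕ.* ((t ℕ.+ t) ℕ.* s))         ≡⟨ S.solve 2 (λ t s → S.con 40 S.:* ((t S.:+ t) S.:* s S.:* ((t S.:+ t) S.:* s)) S.:= t S.:* t S.:* (S.con 160 S.:* (s S.:* s))) refl t s ⟩
      t ℕ.* t ℕ.* (160 ℕ.* (s ℕ.* s))                        ≤⟨ ℕₚ.*-monoʳ-≤ (t ℕ.* t) 160s²≤t ⟩
      t ℕ.* t ℕ.* t                                          ∎
    linear : 5 ℕ.* (4 ℕ.+ k) ℕ.≤ n
    linear = begin
      5 ℕ.* (4 ℕ.+ k)          ≤⟨ ℕₚ.*-monoʳ-≤ 5 (ℕₚ.+-monoˡ-≤ d (ℕ.s≤s (ℕ.z≤n {2 ℕ.+ k}))) ⟩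
      5 ℕ.* (d ℕ.+ d)          ≡⟨ S.solve 1 (λ d → S.con 5 S.:* (d S.:+ d) S.:= S.con 10 S.:* d) refl d ⟩
      10 ℕ.* d                 ≤⟨ ℕₚ.*-mono-≤ (ℕₚ.m≤m+n 10 150) (ℕₚ.≤-trans (ℕₚ.m≤m*n d d) (ℕₚ.m≤m*n s s)) ⟩
      160 ℕ.* (s ℕ.* s)        ≤⟨ ℕₚ.m≤n*m (160 ℕ.* (s ℕ.* s)) s ⟩
      s ℕ.* (160 ℕ.* (s ℕ.* s)) ≤⟨ N≤n ⟩
      n                        ∎

  ratio : ℕ → ℚ
  ratio d = ℕ→ℚ (suc d ℕ.^ 8) * inv (ℕ→ℚ (d ℕ.^ 8))

  -- The inequality is claimed for every n ≥ 1, so the finitely many n without an admissible d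
  -- receive an error large enough to make it trivial.
  crudeBound : ℕ → ℕ
  crudeBound n = T n ℕ.* ((2 ℕ.+ (3 ℕ.* n ℕ.+ 3 ℕ.* n)) ℕ.* (3 ℕ.* n) ℕ.^ (3 ℕ.* n))

  errorAt : ℕ → ℕ → ℚ
  errorAt n zero      = ℕ→ℚ (crudeBound n)
  errorAt n d@(suc _) = ratio d - 1ℚ

  -- Searching below n misses no candidate: `Good n k` contains 5(4 + k) ≤ n and so forces k < n.
  ε : ℕ → ℚ
  ε n = errorAt n (precision n n)

  module _ d .{{_ : ℕ.NonZero d}} where

    0<d⁸ : 0ℚ < ℕ→ℚ (d ℕ.^ 8)
    0<d⁸ = 0<ℕ→ℚ (d ℕ.^ 8) {{ℕₚ.m^n≢0 d 8}}

    d⁸*ratio : ℕ→ℚ (d ℕ.^ 8) * ratio d ≡ ℕ→ℚ (suc d ℕ.^ 8)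
    d⁸*ratio = begin
      x * (y * inv x)    ≡⟨ solve 3 (λ x y i → x :* (y :* i) := y :* (x :* i)) refl x y (inv x) ⟩
      y * (x * inv x)    ≡⟨ cong (y *_) (*-inv 0<d⁸) ⟩
      y * 1ℚ             ≡⟨ *-identityʳ y ⟩
      y                  ∎
      where
      open ≡-Reasoning
      x y : ℚ
      x = ℕ→ℚ (d ℕ.^ 8)
      y = ℕ→ℚ (suc d ℕ.^ 8)

    1≤ratio : 1ℚ ≤ ratio d
    1≤ratio = *-cancelˡ-≤-0< (ℕ→ℚ (d ℕ.^ 8)) 0<d⁸ (begin
      ℕ→ℚ (d ℕ.^ 8) * 1ℚ         ≡⟨ *-identityʳ (ℕ→ℚ (d ℕ.^ 8)) ⟩
      ℕ→ℚ (d ℕ.^ 8)              ≤⟨ ℕ→ℚ-mono-≤ (ℕₚ.^-monoˡ-≤ 8 (ℕₚ.n≤1+n d)) ⟩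
      ℕ→ℚ (suc d ℕ.^ 8)          ≡⟨ d⁸*ratio ⟨
      ℕ→ℚ (d ℕ.^ 8) * ratio d    ∎)
      where open ≤-Reasoning

    mersenne : ℕ → ℕ
    mersenne zero    = 0
    mersenne (suc k) = suc (2 ℕ.* mersenne k)

    -- `mersenne k` is 2^k - 1, the sum of the binomial coefficients C(k, i) with i ≥ 1, so this is
    -- (1 + 1/d)^k ≤ 1 + (2^k - 1)/d. At k = 8 it yields the constant 255.
    d*[1+d]^≤ : ∀ k → d ℕ.* suc d ℕ.^ k ℕ.≤ d ℕ.^ k ℕ.* (d ℕ.+ mersenne k)
    d*[1+d]^≤ zero    = ℕₚ.≤-reflexive (trans (ℕₚ.*-comm d 1) (cong (1 ℕ.*_) (sym (ℕₚ.+-identityʳ d))))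
    d*[1+d]^≤ (suc k) = begin
      d ℕ.* (suc d ℕ.* q)              ≡⟨ S.solve 2 (λ d q → d S.:* ((S.con 1 S.:+ d) S.:* q) S.:= (S.con 1 S.:+ d) S.:* (d S.:* q)) refl d q ⟩
      suc d ℕ.* (d ℕ.* q)              ≤⟨ ℕₚ.*-monoʳ-≤ (suc d) (d*[1+d]^≤ k) ⟩
      suc d ℕ.* (p ℕ.* (d ℕ.+ c))      ≡⟨ S.solve 3 (λ d p c → (S.con 1 S.:+ d) S.:* (p S.:* (d S.:+ c)) S.:= p S.:* (d S.:* (S.con 1 S.:+ d S.:+ c) S.:+ c)) refl d p c ⟩
      p ℕ.* (d ℕ.* (1 ℕ.+ d ℕ.+ c) ℕ.+ c)        ≤⟨ ℕₚ.*-monoʳ-≤ p (ℕₚ.+-monoʳ-≤ (d ℕ.* (1 ℕ.+ d ℕ.+ c)) (ℕₚ.m≤n*m c d)) ⟩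
      p ℕ.* (d ℕ.* (1 ℕ.+ d ℕ.+ c) ℕ.+ d ℕ.* c)  ≡⟨ S.solve 3 (λ d p c → p S.:* (d S.:* (S.con 1 S.:+ d S.:+ c) S.:+ d S.:* c) S.:= d S.:* p S.:* (d S.:+ (S.con 1 S.:+ S.con 2 S.:* c))) refl d p c ⟩
      d ℕ.* p ℕ.* (d ℕ.+ mersenne (suc k))       ∎
      where
      open ℕₚ.≤-Reasoning
      module S = ℕSolver.+-*-Solver
      p q c : ℕ
      p = d ℕ.^ k
      q = suc d ℕ.^ k
      c = mersenne k

    ratio*d≤ : ratio d * ℕ→ℚ d ≤ ℕ→ℚ (d ℕ.+ 255)
    ratio*d≤ = *-cancelˡ-≤-0< (ℕ→ℚ (d ℕ.^ 8)) 0<d⁸ (begin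
      ℕ→ℚ (d ℕ.^ 8) * (ratio d * ℕ→ℚ d)       ≡⟨ *-assoc (ℕ→ℚ (d ℕ.^ 8)) (ratio d) (ℕ→ℚ d) ⟨
      ℕ→ℚ (d ℕ.^ 8) * ratio d * ℕ→ℚ d         ≡⟨ cong (_* ℕ→ℚ d) d⁸*ratio ⟩
      ℕ→ℚ (suc d ℕ.^ 8) * ℕ→ℚ d               ≡⟨ *-comm (ℕ→ℚ (suc d ℕ.^ 8)) (ℕ→ℚ d) ⟩
      ℕ→ℚ d * ℕ→ℚ (suc d ℕ.^ 8)               ≡⟨ ℕ→ℚ-* d (suc d ℕ.^ 8) ⟨
      ℕ→ℚ (d ℕ.* suc d ℕ.^ 8)                 ≤⟨ ℕ→ℚ-mono-≤ (d*[1+d]^≤ 8) ⟩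
      ℕ→ℚ (d ℕ.^ 8 ℕ.* (d ℕ.+ 255))           ≡⟨ ℕ→ℚ-* (d ℕ.^ 8) (d ℕ.+ 255) ⟩
      ℕ→ℚ (d ℕ.^ 8) * ℕ→ℚ (d ℕ.+ 255)         ∎)
      where open ≤-Reasoning

    [ratio-1]*d≤255 : (ratio d - 1ℚ) * ℕ→ℚ d ≤ ℕ→ℚ 255
    [ratio-1]*d≤255 = begin
      (ratio d - 1ℚ) * ℕ→ℚ d             ≡⟨ solve 2 (λ r d → (r :- con 1ℚ) :* d := r :* d :- d) refl (ratio d) (ℕ→ℚ d) ⟩
      ratio d * ℕ→ℚ d - ℕ→ℚ d            ≤⟨ +-monoˡ-≤ (- ℕ→ℚ d) ratio*d≤ ⟩
      ℕ→ℚ (d ℕ.+ 255) - ℕ→ℚ d            ≡⟨ cong (_- ℕ→ℚ d) (ℕ→ℚ-+ d 255) ⟩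
      (ℕ→ℚ d + ℕ→ℚ 255) - ℕ→ℚ d          ≡⟨ solve 2 (λ d c → (d :+ c) :- d := c) refl (ℕ→ℚ d) (ℕ→ℚ 255) ⟩
      ℕ→ℚ 255                            ∎
      where open ≤-Reasoning

  archimedean : ∀ δ → 0ℚ < δ → ∃ λ q → 1ℚ ≤ ℕ→ℚ q * δ
  archimedean δ@(mkℚ (ℤ.+ zero) _ _)     0<δ = contradiction (sym (↥p≡0⇒p≡0 δ refl)) (<⇒≢ 0<δ)
  archimedean δ@(mkℚ ℤ.-[1+ _ ] _ _)   0<δ = contradiction 0<δ (<-asym (negative⁻¹ δ))
  -- The denominator of δ is the witness: times δ it gives the numerator, which is at least 1.
  archimedean δ@(mkℚ (ℤ.+ suc p) q-1 _) 0<δ = suc q-1 , (begin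
    1ℚ                                     ≤⟨ ℕ→ℚ-mono-≤ (ℕ.s≤s (ℕ.z≤n {p})) ⟩
    ℕ→ℚ (suc p)                            ≡⟨ /-*-cancel (suc p) (suc q-1) ⟨
    (ℤ.+ suc p / suc q-1) * ℕ→ℚ (suc q-1)    ≡⟨ cong (_* ℕ→ℚ (suc q-1)) (↥p/↧p≡p δ) ⟩
    δ * ℕ→ℚ (suc q-1)                      ≡⟨ *-comm δ (ℕ→ℚ (suc q-1)) ⟩
    ℕ→ℚ (suc q-1) * δ                      ∎)
    where open ≤-Reasoning

  ε-tendsToZero : TendsToZero ε
  ε-tendsToZero δ 0<δ = N , λ n N≤n → bound n (precision n n)
    (precision-max n (k<n n (good-eventually k N≤n)) (good-eventually k N≤n))
    where
    q k N : ℕ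
    q = proj₁ (archimedean δ 0<δ)
    -- One more than 255, so that 255/d < δ strictly once d ≥ 256q and qδ ≥ 1.
    k = 256 ℕ.* q
    N = (3 ℕ.+ k) ℕ.* (3 ℕ.+ k) ℕ.* (160 ℕ.* ((3 ℕ.+ k) ℕ.* (3 ℕ.+ k) ℕ.* ((3 ℕ.+ k) ℕ.* (3 ℕ.+ k))))
    k<n : ∀ n → Good n k → k ℕ.< n
    k<n n (_ , linear) = ℕₚ.≤-trans (ℕₚ.≤-trans (ℕₚ.m≤n+m (suc k) 3) (ℕₚ.m≤n*m (4 ℕ.+ k) 5)) linear
    bound : ∀ n d → 3 ℕ.+ k ℕ.≤ d → ∣ errorAt n d ∣ < δ
    bound n d@(suc _) k<d = subst (_< δ) (sym (0≤p⇒∣p∣≡p (p≤q⇒0≤q-p (1≤ratio d)))) (*-cancelʳ-<-nonNeg (ℕ→ℚ d) {{nonNegative (ℕ→ℚ-nonNeg d)}} (begin-strict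
      (ratio d - 1ℚ) * ℕ→ℚ d      ≤⟨ [ratio-1]*d≤255 d ⟩
      ℕ→ℚ 255                     ≡⟨ +-identityˡ (ℕ→ℚ 255) ⟨
      0ℚ + ℕ→ℚ 255                <⟨ +-monoˡ-< (ℕ→ℚ 255) (positive⁻¹ 1ℚ) ⟩
      ℕ→ℚ 256                     ≡⟨ *-identityʳ (ℕ→ℚ 256) ⟨
      ℕ→ℚ 256 * 1ℚ                ≤⟨ *ˡ-mono-≤ (ℕ→ℚ-nonNeg 256) (proj₂ (archimedean δ 0<δ)) ⟩
      ℕ→ℚ 256 * (ℕ→ℚ q * δ)       ≡⟨ *-assoc (ℕ→ℚ 256) (ℕ→ℚ q) δ ⟨
      ℕ→ℚ 256 * ℕ→ℚ q * δ         ≡⟨ cong (_* δ) (ℕ→ℚ-* 256 q) ⟨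
      ℕ→ℚ k * δ                   ≤⟨ *ʳ-mono-≤ (<⇒≤ 0<δ) (ℕ→ℚ-mono-≤ (ℕₚ.≤-trans (ℕₚ.m≤n+m k 3) k<d)) ⟩
      ℕ→ℚ d * δ                   ≡⟨ *-comm (ℕ→ℚ d) δ ⟩
      δ * ℕ→ℚ d                   ∎))
      where open ≤-Reasoning

  -- The inequality for each n and each partial sum.

  module _ n (1≤n : 1 ℕ.≤ n) (K : ℕ) where

    private instance
      n≢0 : ℕ.NonZero n
      n≢0 = ℕ.>-nonZero 1≤n
      3n≢0 : ℕ.NonZero (3 ℕ.* n)
      3n≢0 = ℕₚ.m*n≢0 3 n

    open ExpPartial (3 ℕ.* n)

    C : ℕ
    C = (2 ℕ.+ (3 ℕ.* n ℕ.+ 3 ℕ.* n)) ℕ.* (3 ℕ.* n) ℕ.^ (3 ℕ.* n)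

    F! E : ℚ
    F! = ℕ→ℚ ((3 ℕ.* n) !)
    E  = expPartial (3 ℕ.* n) K

    1≤⇒≤^ : ∀ {p} → 1ℚ ≤ p → p ≤ p ^ℚ n
    1≤⇒≤^ {p} 1≤p = go n 1≤n
      where
      open ≤-Reasoning
      1≤^ : ∀ k → 1ℚ ≤ p ^ℚ k
      1≤^ zero    = ≤-refl
      1≤^ (suc k) = *-mono₂-≤ 0≤1 (^ℚ-nonNeg k (≤-trans 0≤1 1≤p)) 1≤p (1≤^ k)
      go : ∀ m → 1 ℕ.≤ m → p ≤ p ^ℚ m
      go (suc m) _ = begin
        p             ≡⟨ *-identityʳ p ⟨
        p * 1ℚ        ≤⟨ *ˡ-mono-≤ (≤-trans 0≤1 1≤p) (1≤^ m) ⟩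
        p * p ^ℚ m    ∎

    -- The base (1 + `crudeBound n`) n already exceeds the left-hand side, and a base of at least 1
    -- is at most its n-th power since n ≥ 1.
    crude : ℕ→ℚ (T n) * E ≤ ((1ℚ + ℕ→ℚ (crudeBound n)) * ℕ→ℚ n) ^ℚ n
    crude = begin
      ℕ→ℚ (T n) * E                         ≤⟨ *ˡ-mono-≤ (ℕ→ℚ-nonNeg (T n)) E≤C ⟩
      ℕ→ℚ (T n) * ℕ→ℚ C                     ≡⟨ ℕ→ℚ-* (T n) C ⟨
      X                                     ≡⟨ +-identityˡ X ⟨
      0ℚ + X                                ≤⟨ +-monoˡ-≤ X 0≤1 ⟩
      1ℚ + X                                ≡⟨ *-identityʳ (1ℚ + X) ⟨
      (1ℚ + X) * 1ℚ                         ≤⟨ *ˡ-mono-≤ 0≤1+X (ℕ→ℚ-mono-≤ 1≤n) ⟩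
      (1ℚ + X) * ℕ→ℚ n                      ≤⟨ 1≤⇒≤^ (*-mono₂-≤ 0≤1 (ℕ→ℚ-nonNeg n) 1≤1+X (ℕ→ℚ-mono-≤ 1≤n)) ⟩
      ((1ℚ + X) * ℕ→ℚ n) ^ℚ n               ∎
      where
      open ≤-Reasoning
      X : ℚ
      X = ℕ→ℚ (crudeBound n)
      1≤1+X : 1ℚ ≤ 1ℚ + X
      1≤1+X = ≤-trans (≤-reflexive (sym (+-identityʳ 1ℚ))) (+-monoʳ-≤ 1ℚ (ℕ→ℚ-nonNeg (crudeBound n)))
      0≤1+X : 0ℚ ≤ 1ℚ + X
      0≤1+X = ≤-trans 0≤1 1≤1+X
      E≤C : E ≤ ℕ→ℚ C
      E≤C = begin
        E                                              ≤⟨ expPartial-bound K ⟩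
        c * M                                          ≡⟨ cong (c *_) (*-identityʳ M) ⟨
        c * (M * 1ℚ)                                   ≤⟨ *ˡ-mono-≤ (ℕ→ℚ-nonNeg (2 ℕ.+ (3 ℕ.* n ℕ.+ 3 ℕ.* n))) (*ˡ-mono-≤ 0≤M (ℕ→ℚ-mono-≤ (ℕₚ.1≤n! (3 ℕ.* n)))) ⟩
        c * (M * F!)                                   ≡⟨ cong (c *_) M*! ⟩
        c * ℕ→ℚ ((3 ℕ.* n) ℕ.^ (3 ℕ.* n))              ≡⟨ ℕ→ℚ-* (2 ℕ.+ (3 ℕ.* n ℕ.+ 3 ℕ.* n)) ((3 ℕ.* n) ℕ.^ (3 ℕ.* n)) ⟨
        ℕ→ℚ C                                          ∎
        where
        c : ℚ
        c = ℕ→ℚ (2 ℕ.+ (3 ℕ.* n ℕ.+ 3 ℕ.* n))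

    -- Multiplying by d^(8n) and (3n)! clears the denominators of `ratio` and of the bound on E;
    -- what remains is `count-≤` between naturals.
    fine : ∀ k → Good n k → ℕ→ℚ (T n) * E ≤ (ratio (3 ℕ.+ k) * ℕ→ℚ n) ^ℚ n
    fine k (cubic , linear) = *-cancelˡ-≤-0< (x ^ℚ n) (subst (0ℚ <_) (ℕ→ℚ-^ (d ℕ.^ 8) n) (0<ℕ→ℚ ((d ℕ.^ 8) ℕ.^ n) {{ℕₚ.m^n≢0 (d ℕ.^ 8) n {{ℕₚ.m^n≢0 d 8}}}}))
      (*-cancelˡ-≤-0< F! (0<! (3 ℕ.* n)) (begin
        F! * (x ^ℚ n * (ℕ→ℚ (T n) * E))                      ≡⟨ solve 4 (λ f x t e → f :* (x :* (t :* e)) := t :* (e :* f) :* x) refl F! (x ^ℚ n) (ℕ→ℚ (T n)) E ⟩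
        ℕ→ℚ (T n) * (E * F!) * x ^ℚ n                        ≤⟨ *ʳ-mono-≤ (^ℚ-nonNeg n (ℕ→ℚ-nonNeg (d ℕ.^ 8))) (*ˡ-mono-≤ (ℕ→ℚ-nonNeg (T n)) (expPartial*! K)) ⟩
        ℕ→ℚ (T n) * ℕ→ℚ C * x ^ℚ n                           ≡⟨ cong₂ _*_ (sym (ℕ→ℚ-* (T n) C)) (sym (ℕ→ℚ-^ (d ℕ.^ 8) n)) ⟩
        ℕ→ℚ (T n ℕ.* C) * ℕ→ℚ ((d ℕ.^ 8) ℕ.^ n)              ≡⟨ ℕ→ℚ-* (T n ℕ.* C) ((d ℕ.^ 8) ℕ.^ n) ⟨
        ℕ→ℚ (T n ℕ.* C ℕ.* (d ℕ.^ 8) ℕ.^ n)                  ≤⟨ ℕ→ℚ-mono-≤ count ⟩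
        ℕ→ℚ ((3 ℕ.* n) ! ℕ.* (suc d ℕ.^ 8 ℕ.* n) ℕ.^ n)      ≡⟨ ℕ→ℚ-* ((3 ℕ.* n) !) ((suc d ℕ.^ 8 ℕ.* n) ℕ.^ n) ⟩
        F! * ℕ→ℚ ((suc d ℕ.^ 8 ℕ.* n) ℕ.^ n)                 ≡⟨ cong (F! *_) (ℕ→ℚ-^ (suc d ℕ.^ 8 ℕ.* n) n) ⟩
        F! * ℕ→ℚ (suc d ℕ.^ 8 ℕ.* n) ^ℚ n                    ≡⟨ cong (λ z → F! * z ^ℚ n) (begin-equality
          ℕ→ℚ (suc d ℕ.^ 8 ℕ.* n)                ≡⟨ ℕ→ℚ-* (suc d ℕ.^ 8) n ⟩
          ℕ→ℚ (suc d ℕ.^ 8) * ℕ→ℚ n              ≡⟨ cong (_* ℕ→ℚ n) (d⁸*ratio d) ⟨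
          x * ratio d * ℕ→ℚ n                    ≡⟨ *-assoc x (ratio d) (ℕ→ℚ n) ⟩
          x * (ratio d * ℕ→ℚ n)                  ∎) ⟩
        F! * (x * (ratio d * ℕ→ℚ n)) ^ℚ n                    ≡⟨ cong (F! *_) (^ℚ-distrib-* x (ratio d * ℕ→ℚ n) n) ⟩
        F! * (x ^ℚ n * (ratio d * ℕ→ℚ n) ^ℚ n)               ∎))
      where
      open ≤-Reasoning
      d : ℕ
      d = 3 ℕ.+ k
      x : ℚ
      x = ℕ→ℚ (d ℕ.^ 8)
      4≤n : 4 ℕ.≤ n
      4≤n = ℕₚ.≤-trans (ℕₚ.≤-trans (ℕₚ.m≤m+n 4 k) (ℕₚ.m≤n*m (4 ℕ.+ k) 5)) linear
      d²t≤n : d ℕ.* d ℕ.* blockCount n k ℕ.≤ n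
      d²t≤n = ℕₚ.≤-trans (ℕₚ.≤-reflexive (ℕₚ.*-comm (d ℕ.* d) (blockCount n k))) (DivMod.m/n*n≤m n (d ℕ.* d))
      6n+2≡ : 6 ℕ.* n ℕ.+ 2 ≡ 2 ℕ.+ (3 ℕ.* n ℕ.+ 3 ℕ.* n)
      6n+2≡ = S.solve 1 (λ n → S.con 6 S.:* n S.:+ S.con 2 S.:= S.con 2 S.:+ (S.con 3 S.:* n S.:+ S.con 3 S.:* n)) refl n
        where module S = ℕSolver.+-*-Solver
      count : T n ℕ.* C ℕ.* (d ℕ.^ 8) ℕ.^ n ℕ.≤ (3 ℕ.* n) ! ℕ.* (suc d ℕ.^ 8 ℕ.* n) ℕ.^ n
      count = subst (λ z → T n ℕ.* (z ℕ.* (3 ℕ.* n) ℕ.^ (3 ℕ.* n)) ℕ.* (d ℕ.^ 8) ℕ.^ n ℕ.≤ (3 ℕ.* n) ! ℕ.* (suc d ℕ.^ 8 ℕ.* n) ℕ.^ n) 6n+2≡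
        (Asymptotics.count-≤ {d} {blockCount n k} {n} (ℕₚ.m≤m+n 3 k) d²t≤n cubic linear {T n} (T-bound n 4≤n))

    T*expPartial≤ : ℕ→ℚ (T n) * E ≤ ((1ℚ + ε n) * ℕ→ℚ n) ^ℚ n
    T*expPartial≤ with precision-good n n
    ... | inj₁ eq = subst (λ d → ℕ→ℚ (T n) * E ≤ ((1ℚ + errorAt n d) * ℕ→ℚ n) ^ℚ n) (sym eq) crude
    ... | inj₂ (k , eq , good) = subst (λ d → ℕ→ℚ (T n) * E ≤ ((1ℚ + errorAt n d) * ℕ→ℚ n) ^ℚ n) (sym eq)
      (subst (λ z → ℕ→ℚ (T n) * E ≤ (z * ℕ→ℚ n) ^ℚ n) (solve 1 (λ r → r := con 1ℚ :+ (r :- con 1ℚ)) refl (ratio (3 ℕ.+ k))) (fine k good))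

open import Data.Nat using (ℕ; _≤_)
open import Data.Rational using (ℚ; _+_; _*_; 1ℚ) renaming (_≤_ to _≤ℚ_)
open import Data.Product using (∃; _×_)

theorem2 : ∃ λ (ε : ℕ → ℚ) → TendsToZero ε ×
    (∀ (n : ℕ) → 1 ≤ n → ∀ (K : ℕ) →
    ℕ→ℚ (T n) * expPartial (3 Data.Nat.* n) K ≤ℚ ((1ℚ + ε n) * ℕ→ℚ n) ^ℚ n)
theorem2 = ErrorTerm.ε , ErrorTerm.ε-tendsToZero , ErrorTerm.T*expPartial≤
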